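{- For $n>1$ and $k>5$ odd, let $NC(2nk+1,k)$ be the number of non-isomorphic cyclic $(K_{2nk+1},C_k)$-designs. Then there is an integer $N$ such that for all $n\ge N$ and all odd $k>5$: - if $n\not\equiv 4\pmod 7$, then $NC(2nk+1,k)\ge \dfrac{(2.49)^n}{k}$; - if $n\equiv 4\pmod 7$, then $NC(2nk+1,k)\ge \dfrac{(3.35)^n}{k}$.
   Context: A $(K_v,C_k)$-design (or $k$-cycle system of the complete graph $K_v$) is a set $\mathcal{B}$ of $k$-cycles of $K_v$ whose edges partition the edge-set of $K_v$. It is cyclic if the vertex-set can be identified with $\mathbb{Z}_v$ in such a way that $B=(b_1,\dots,b_k)\in\mathcal{B}$ implies $B+z=(b_1+z,\dots,b_k+z)\in\mathcal{B}$ for all $z\in\mathbb{Z}_v$. Two $(K_v,C_k)$-designs with cycle sets $\mathcal{B}$ and $\mathcal{B}'$ are isomorphic if there is a permutation of the vertex-set turning $\mathcal{B}$ into $\mathcal{B}'$. $NC(v,k)$ is the number of cyclic $(K_v,C_k)$-designs up to isomorphism. -}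

module Defs where

open import Data.Fin.Base using (Fin; zero; suc; toℕ; punchIn)
open import Data.Fin.Permutation as Perm
  using (Permutation′; _⟨$⟩ʳ_; _∘ₚ_; insert; remove)
import Data.Fin.Properties as Fin
open import Data.List.Base as List
  using (List; []; _∷_; _++_; allFin; cartesianProductWith; deduplicate; filter; length)
import Data.List.Membership.DecPropositional as DecPropositionalMembership
open import Data.List.Membership.Propositional using () renaming (_∈_ to _∈≡_; find to find≡)
open import Data.List.Membership.Propositional.Properties
  using (∈-allFin; ∈-cartesianProductWith⁺; ∈-filter⁺; ∈-filter⁻; ∈-++⁺ˡ; ∈-++⁺ʳ)
  renaming (∈-map⁺ to ∈≡-map⁺)
import Data.List.Membership.Setoid as SetoidMembership
import Data.List.Properties as List
import Data.List.Relation.Binary.Subset.Setoid as SetoidSubset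
import Data.List.Relation.Binary.Subset.Setoid.Properties as SubsetProperties
open import Data.List.Relation.Unary.All as All using (All; []; _∷_)
open import Data.List.Relation.Unary.Any as Any using (Any; here; there)
open import Data.List.Relation.Unary.Enumerates.Setoid using (IsEnumeration)
import Data.List.Relation.Unary.Enumerates.Setoid.Properties as Enumerates
import Data.List.Relation.Unary.Unique.DecSetoid.Properties as DecUnique
import Data.List.Relation.Unary.Unique.Setoid as ListUnique
open import Data.Nat.Base using (ℕ; zero; suc; _+_; NonZero)
open import Data.Nat.DivMod using (_mod_)
open import Data.Product using (∃!)
open import Data.Product.Base using (∃; _×_; _,_; proj₁; proj₂; swap)
open import Data.Rational.Base using (+-*-rawSemiring)
open import Data.Sum.Base as Sum using (_⊎_; inj₁; inj₂)
open import Data.Vec.Base as Vec using (Vec; []; _∷_; lookup)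
import Data.Vec.Properties as Vec
import Data.Vec.Relation.Unary.AllPairs as VecAllPairs
open import Data.Vec.Relation.Unary.Unique.Propositional using (Unique)
open import Function.Base using (_∘_; id)
open import Function.Bundles using (_⇔_; mk⇔; Equivalence)
open import Function.Construct.Composition using (_⇔-∘_)
open import Function.Construct.Identity using (⇔-id)
open import Function.Construct.Symmetry using (⇔-sym)
open import Level using (0ℓ)
open import Relation.Binary.Bundles using (Setoid; DecSetoid)
open import Relation.Binary.Definitions using () renaming (Decidable to Decidable₂)
open import Relation.Binary.PropositionalEquality.Core
  using (_≡_; _≢_; _≗_; refl; sym; trans; cong; subst)
open import Relation.Nullary.Decidable
  using (Dec; yes; no; map′; ¬?; _×-dec_; _⊎-dec_; _→-dec_)
open import Relation.Unary using (Decidable)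

open import Algebra.Definitions.RawSemiring +-*-rawSemiring public
  using () renaming (_^_ to _^ℚ_)

infixl 6 _⊕_

_⊕_ : ∀ {m} → Fin m → Fin m → Fin m
_⊕_ {m} x y = (toℕ x + toℕ y) mod m
  where instance
    m≢0 : NonZero m
    m≢0 = Fin.nonZeroIndex x

next : ∀ {m} → Fin m → Fin m
next {m} i = suc (toℕ i) mod m
  where instance
    m≢0 : NonZero m
    m≢0 = Fin.nonZeroIndex i

module _ {v k : ℕ} where

  -- The edge {x , y} of (b₁ , … , bₖ), with indices read cyclically.
  Edge : Vec (Fin v) k → Fin v → Fin v → Set
  Edge B x y = ∃ λ i →
      (x ≡ lookup B i × y ≡ lookup B (next i))
    ⊎ (y ≡ lookup B i × x ≡ lookup B (next i))

  infix 4 _≈_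

  -- A cycle is a subgraph of K_v: tuples differing by a rotation or a
  -- reflection denote the same one.
  record _≈_ (B C : Vec (Fin v) k) : Set where
    constructor mk≈
    field
      sameEdges : ∀ x y → Edge B x y ⇔ Edge C x y

  open _≈_ public

cycleSetoid : (v k : ℕ) → Setoid 0ℓ 0ℓ
cycleSetoid v k = record
  { Carrier       = Vec (Fin v) k
  ; _≈_           = _≈_
  ; isEquivalence = record
    { refl  = mk≈ λ _ _ → ⇔-id _
    ; sym   = λ (mk≈ e) → mk≈ λ x y → ⇔-sym (e x y)
    ; trans = λ (mk≈ e) (mk≈ f) → mk≈ λ x y → f x y ⇔-∘ e x y
    }
  }

module _ {v k : ℕ} where

  open SetoidMembership (cycleSetoid v k) public using (_∈_)
  open SetoidSubset (cycleSetoid v k) public using (_⊆_)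

  infix 4 _≋_

  _≋_ : List (Vec (Fin v) k) → List (Vec (Fin v) k) → Set
  𝓑 ≋ 𝓒 = 𝓑 ⊆ 𝓒 × 𝓒 ⊆ 𝓑

  -- A finite set of cycles is a list read up to _≋_, so order and repetition
  -- in the list are immaterial.  The tuples denote k-cycles only for k ≥ 3.
  record IsDesign (𝓑 : List (Vec (Fin v) k)) : Set where
    field
      cycles    : All Unique 𝓑
      partition : ∀ x y → x ≢ y → ∃! _≈_ λ B → B ∈ 𝓑 × Edge B x y

  relabel : Permutation′ v → List (Vec (Fin v) k) → List (Vec (Fin v) k)
  relabel σ = List.map (Vec.map (σ ⟨$⟩ʳ_))

  translate : Fin v → Vec (Fin v) k → Vec (Fin v) k
  translate z = Vec.map (_⊕ z)

  TranslationInvariant : List (Vec (Fin v) k) → Set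
  TranslationInvariant 𝓑 = ∀ z B → B ∈ 𝓑 → translate z B ∈ 𝓑

  -- φ is the identification of the vertex set with ℤ/v.
  IsCyclic : List (Vec (Fin v) k) → Set
  IsCyclic 𝓑 = ∃ λ φ → TranslationInvariant (relabel φ 𝓑)

  Isomorphic : List (Vec (Fin v) k) → List (Vec (Fin v) k) → Set
  Isomorphic 𝓑 𝓒 = ∃ λ σ → relabel σ 𝓑 ≋ 𝓒

record CyclicDesign (v k : ℕ) : Set where
  constructor mkCyclicDesign
  field
    blocks   : List (Vec (Fin v) k)
    isDesign : IsDesign blocks
    isCyclic : IsCyclic blocks

open CyclicDesign public

infix 4 _≅_

_≅_ : ∀ {v k} → CyclicDesign v k → CyclicDesign v k → Set
D ≅ E = Isomorphic (blocks D) (blocks E)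

module _ {v k : ℕ} where

  private
    S = cycleSetoid v k

  open Setoid S using () renaming (refl to ≈-refl; sym to ≈-sym; trans to ≈-trans)

  map-edge : ∀ (f : Fin v → Fin v) (B : Vec (Fin v) k) {a b} → Edge B a b →
             Edge (Vec.map f B) (f a) (f b)
  map-edge f B (i , e) = i , Sum.map step step e
    where
    step : ∀ {a b} → a ≡ lookup B i × b ≡ lookup B (next i) →
           f a ≡ lookup (Vec.map f B) i × f b ≡ lookup (Vec.map f B) (next i)
    step (refl , refl) = sym (Vec.lookup-map i f B) , sym (Vec.lookup-map (next i) f B)

  unmap-edge : ∀ (f : Fin v → Fin v) (B : Vec (Fin v) k) {x y} → Edge (Vec.map f B) x y →
               ∃ λ a → ∃ λ b → x ≡ f a × y ≡ f b × Edge B a b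
  unmap-edge f B (i , inj₁ (refl , refl)) =
    _ , _ , Vec.lookup-map i f B , Vec.lookup-map (next i) f B , i , inj₁ (refl , refl)
  unmap-edge f B (i , inj₂ (refl , refl)) =
    _ , _ , Vec.lookup-map (next i) f B , Vec.lookup-map i f B , i , inj₂ (refl , refl)

  map-≈ : ∀ (f : Fin v → Fin v) {B C : Vec (Fin v) k} → B ≈ C → Vec.map f B ≈ Vec.map f C
  map-≈ f B≈C = mk≈ λ _ _ → mk⇔ (half B≈C) (half (≈-sym B≈C))
    where
    half : ∀ {B C x y} → B ≈ C → Edge (Vec.map f B) x y → Edge (Vec.map f C) x y
    half {B} {C} (mk≈ e) p with unmap-edge f B p
    ... | a , b , refl , refl , q = map-edge f C (Equivalence.to (e a b) q)

  relabel-⊆ : ∀ σ {𝓑 𝓒 : List (Vec (Fin v) k)} → 𝓑 ⊆ 𝓒 → relabel σ 𝓑 ⊆ relabel σ 𝓒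
  relabel-⊆ σ = SubsetProperties.map⁺ S S (map-≈ (σ ⟨$⟩ʳ_))

  relabel-≡ : ∀ {σ τ : Permutation′ v} → σ Perm.≈ τ → relabel {k = k} σ ≗ relabel τ
  relabel-≡ σ≈τ = List.map-cong (Vec.map-cong σ≈τ)

  relabel-∘ : ∀ (σ τ : Permutation′ v) 𝓑 →
              relabel {k = k} τ (relabel σ 𝓑) ≡ relabel (σ ∘ₚ τ) 𝓑
  relabel-∘ σ τ 𝓑 = trans (sym (List.map-∘ 𝓑))
    (List.map-cong (λ B → sym (Vec.map-∘ _ _ B)) 𝓑)

  relabel-id : ∀ {σ : Permutation′ v} → σ Perm.≈ Perm.id → ∀ 𝓑 → relabel {k = k} σ 𝓑 ≡ 𝓑
  relabel-id σ≈id 𝓑 = trans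
    (List.map-cong (λ B → trans (Vec.map-cong σ≈id B) (Vec.map-id B)) 𝓑) (List.map-id 𝓑)

  ≡⇒≋ : ∀ {𝓑 𝓒 : List (Vec (Fin v) k)} → 𝓑 ≡ 𝓒 → 𝓑 ≋ 𝓒
  ≡⇒≋ refl = id , id

  ≋-trans : ∀ {𝓑 𝓒 𝓓 : List (Vec (Fin v) k)} → 𝓑 ≋ 𝓒 → 𝓒 ≋ 𝓓 → 𝓑 ≋ 𝓓
  ≋-trans (p , p′) (q , q′) = (λ m → q (p m)) , (λ m → p′ (q′ m))

  relabel-≋ : ∀ σ {𝓑 𝓒 : List (Vec (Fin v) k)} → 𝓑 ≋ 𝓒 → relabel σ 𝓑 ≋ relabel σ 𝓒
  relabel-≋ σ (p , q) = relabel-⊆ σ p , relabel-⊆ σ q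

  ≋⇒Isomorphic : ∀ {𝓑 𝓒 : List (Vec (Fin v) k)} → 𝓑 ≋ 𝓒 → Isomorphic 𝓑 𝓒
  ≋⇒Isomorphic {𝓑} e = Perm.id , ≋-trans (≡⇒≋ (relabel-id {σ = Perm.id} (λ _ → refl) 𝓑)) e

  Isomorphic-sym : ∀ {𝓑 𝓒 : List (Vec (Fin v) k)} → Isomorphic 𝓑 𝓒 → Isomorphic 𝓒 𝓑
  Isomorphic-sym {𝓑} (σ , e) = Perm.flip σ ,
    ≋-trans (relabel-≋ (Perm.flip σ) (swap e))
      (≡⇒≋ (trans (relabel-∘ σ (Perm.flip σ) 𝓑)
                  (relabel-id {σ ∘ₚ Perm.flip σ} (λ _ → Perm.inverseˡ σ) 𝓑)))

  Isomorphic-trans : ∀ {𝓑 𝓒 𝓓 : List (Vec (Fin v) k)} →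
                     Isomorphic 𝓑 𝓒 → Isomorphic 𝓒 𝓓 → Isomorphic 𝓑 𝓓
  Isomorphic-trans {𝓑} (σ , e) (τ , f) = σ ∘ₚ τ ,
    ≋-trans (≡⇒≋ (sym (relabel-∘ σ τ 𝓑))) (≋-trans (relabel-≋ τ e) f)

  edge? : ∀ (B : Vec (Fin v) k) x y → Dec (Edge B x y)
  edge? B x y = Fin.any? λ i →
    (x Fin.≟ lookup B i ×-dec y Fin.≟ lookup B (next i))
    ⊎-dec (y Fin.≟ lookup B i ×-dec x Fin.≟ lookup B (next i))

  infix 4 _≈?_ _∈?_ _⊆?_

  _≈?_ : Decidable₂ (_≈_ {v} {k})
  B ≈? C = map′ mk≈ sameEdges (Fin.all? λ x → Fin.all? λ y →
    map′ (λ (p , q) → mk⇔ p q) (λ e → Equivalence.to e , Equivalence.from e)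
      ((edge? B x y →-dec edge? C x y) ×-dec (edge? C x y →-dec edge? B x y)))

  _∈?_ : Decidable₂ (_∈_ {v} {k})
  B ∈? 𝓑 = Any.any? (B ≈?_) 𝓑

  ∈-resp : ∀ {B C : Vec (Fin v) k} {𝓑} → B ≈ C → B ∈ 𝓑 → C ∈ 𝓑
  ∈-resp B≈C = Any.map (≈-trans (≈-sym B≈C))

  ∈≡⇒∈ : ∀ {B : Vec (Fin v) k} {𝓑} → B ∈≡ 𝓑 → B ∈ 𝓑
  ∈≡⇒∈ = Any.map λ { refl → ≈-refl }

  ∀∈? : ∀ {P : Vec (Fin v) k → Set} → (∀ {B C} → B ≈ C → P B → P C) → Decidable P →
        ∀ 𝓑 → Dec (∀ B → B ∈ 𝓑 → P B)
  ∀∈? {P} resp P? 𝓑 = map′ to from (All.all? P? 𝓑)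
    where
    to : All P 𝓑 → ∀ B → B ∈ 𝓑 → P B
    to ps B B∈𝓑 with find≡ B∈𝓑
    ... | C , C∈𝓑 , B≈C = resp (≈-sym B≈C) (All.lookup ps C∈𝓑)

    from : (∀ B → B ∈ 𝓑 → P B) → All P 𝓑
    from h = All.tabulate λ m → h _ (∈≡⇒∈ m)

  ∃∈? : ∀ {P : Vec (Fin v) k → Set} → (∀ {B C} → B ≈ C → P B → P C) → Decidable P →
        ∀ 𝓑 → Dec (∃ λ B → B ∈ 𝓑 × P B)
  ∃∈? {P} resp P? 𝓑 = map′ to from (Any.any? P? 𝓑)
    where
    to : Any P 𝓑 → ∃ λ B → B ∈ 𝓑 × P B
    to p with find≡ p
    ... | B , B∈𝓑 , pB = B , ∈≡⇒∈ B∈𝓑 , pB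

    from : (∃ λ B → B ∈ 𝓑 × P B) → Any P 𝓑
    from (B , B∈𝓑 , pB) = Any.map (λ B≈C → resp B≈C pB) B∈𝓑

  _⊆?_ : Decidable₂ (_⊆_ {v} {k})
  𝓑 ⊆? 𝓒 = map′ (λ h {B} → h B) (λ h B → h {B}) (∀∈? ∈-resp (_∈? 𝓒) 𝓑)

  isDesign? : Decidable (IsDesign {v} {k})
  isDesign? 𝓑 =
    map′ (λ (p , q) → record { cycles = p ; partition = q })
         (λ d → IsDesign.cycles d , IsDesign.partition d)
      (All.all? (VecAllPairs.allPairs? λ x y → ¬? (x Fin.≟ y)) 𝓑
       ×-dec Fin.all? λ x → Fin.all? λ y → ¬? (x Fin.≟ y) →-dec unique? x y)
    where
    module _ (x y : Fin v) where
      Through : Vec (Fin v) k → Set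
      Through B = Edge B x y

      through-resp : ∀ {B C} → B ≈ C → Through B → Through C
      through-resp e = Equivalence.to (sameEdges e x y)

      Only : Vec (Fin v) k → Set
      Only B = Through B × (∀ C → C ∈ 𝓑 → Through C → B ≈ C)

      unique? : Dec (∃! _≈_ λ B → B ∈ 𝓑 × Edge B x y)
      unique? = map′
        (λ (B , m , t , u) → B , (m , t) , λ {C} (n , s) → u C n s)
        (λ (B , (m , t) , u) → B , m , t , λ C n s → u (n , s))
        (∃∈? {P = Only}
          (λ B≈C (t , u) → through-resp B≈C t , λ D n s → ≈-trans (≈-sym B≈C) (u D n s))
          (λ B → edge? B x y ×-dec
            ∀∈? (λ C≈D h s → ≈-trans (h (through-resp (≈-sym C≈D) s)) C≈D)
                (λ C → edge? C x y →-dec (B ≈? C)) 𝓑)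
          𝓑)

insert-cong : ∀ {n} j {σ τ : Permutation′ n} → σ Perm.≈ τ →
              insert zero j σ Perm.≈ insert zero j τ
insert-cong j _ zero = refl
insert-cong j {σ} {τ} σ≈τ (suc i) = trans (Perm.insert-punchIn zero j σ i)
  (trans (cong (punchIn j) (σ≈τ i)) (sym (Perm.insert-punchIn zero j τ i)))

permutations : ∀ n → List (Permutation′ n)
permutations zero    = Perm.id ∷ []
permutations (suc n) = cartesianProductWith (insert zero) (allFin (suc n)) (permutations n)

permutations-complete : ∀ {n} (σ : Permutation′ n) →
                        ∃ λ τ → τ ∈≡ permutations n × σ Perm.≈ τ
permutations-complete {zero} σ = Perm.id , here refl , λ ()
permutations-complete {suc n} σ with permutations-complete (remove zero σ)
... | τ , τ∈ , σ≈τ = insert zero (σ ⟨$⟩ʳ zero) τ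
                   , ∈-cartesianProductWith⁺ (insert zero) (∈-allFin _) τ∈
                   , λ i → trans (sym (Perm.insert-remove zero σ i))
                                 (insert-cong (σ ⟨$⟩ʳ zero) {remove zero σ} {τ} σ≈τ i)

∃relabel? : ∀ {v k} {P : List (Vec (Fin v) k) → Set} → Decidable P →
            ∀ 𝓑 → Dec (∃ λ σ → P (relabel σ 𝓑))
∃relabel? {v} {P = P} P? 𝓑 = map′ Any.satisfied from
  (Any.any? (λ σ → P? (relabel σ 𝓑)) (permutations v))
  where
  from : (∃ λ σ → P (relabel σ 𝓑)) → Any (λ σ → P (relabel σ 𝓑)) (permutations v)
  from (σ , p) with permutations-complete σ
  ... | τ , τ∈ , σ≈τ =
    Any.map (λ { refl → subst P (relabel-≡ {σ = σ} {τ} σ≈τ 𝓑) p }) τ∈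

isCyclic? : ∀ {v k} → Decidable (IsCyclic {v} {k})
isCyclic? = ∃relabel? λ 𝓑 → Fin.all? λ z →
  ∀∈? (λ B≈C → ∈-resp (map-≈ (_⊕ z) B≈C)) (λ B → translate z B ∈? 𝓑) 𝓑

isomorphic? : ∀ {v k} → Decidable₂ (Isomorphic {v} {k})
isomorphic? 𝓑 𝓒 = ∃relabel? (λ 𝓓 → (𝓓 ⊆? 𝓒) ×-dec (𝓒 ⊆? 𝓓)) 𝓑

designSetoid : (v k : ℕ) → DecSetoid 0ℓ 0ℓ
designSetoid v k = record
  { Carrier          = CyclicDesign v k
  ; _≈_              = _≅_
  ; isDecEquivalence = record
    { isEquivalence = record
      { refl  = ≋⇒Isomorphic (id , id)
      ; sym   = Isomorphic-sym
      ; trans = Isomorphic-trans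
      }
    ; _≟_ = λ D E → isomorphic? (blocks D) (blocks E)
    }
  }

tuples : ∀ v k → List (Vec (Fin v) k)
tuples v zero    = [] ∷ []
tuples v (suc k) = cartesianProductWith _∷_ (allFin v) (tuples v k)

tuples-complete : ∀ {v k} (B : Vec (Fin v) k) → B ∈≡ tuples v k
tuples-complete []      = here refl
tuples-complete (x ∷ B) = ∈-cartesianProductWith⁺ _∷_ (∈-allFin x) (tuples-complete B)

sublists : ∀ {A : Set} → List A → List (List A)
sublists []       = [] ∷ []
sublists (x ∷ xs) = List.map (x ∷_) (sublists xs) ++ sublists xs

filter∈sublists : ∀ {A : Set} {P : A → Set} (P? : Decidable P) xs →
                  filter P? xs ∈≡ sublists xs
filter∈sublists P? [] = here refl
filter∈sublists P? (x ∷ xs) with P? x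
... | yes _ = ∈-++⁺ˡ (∈≡-map⁺ (x ∷_) (filter∈sublists P? xs))
... | no  _ = ∈-++⁺ʳ (List.map (x ∷_) (sublists xs)) (filter∈sublists P? xs)

keepDesigns : ∀ {v k} → List (List (Vec (Fin v) k)) → List (CyclicDesign v k)
keepDesigns [] = []
keepDesigns (𝓑 ∷ 𝓑s) with isDesign? 𝓑 ×-dec isCyclic? 𝓑
... | yes (d , c) = mkCyclicDesign 𝓑 d c ∷ keepDesigns 𝓑s
... | no  _       = keepDesigns 𝓑s

keepDesigns⁺ : ∀ {v k} {𝓑 : List (Vec (Fin v) k)} {𝓑s} → IsDesign 𝓑 → IsCyclic 𝓑 →
               𝓑 ∈≡ 𝓑s → Any (λ D → 𝓑 ≡ blocks D) (keepDesigns 𝓑s)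
keepDesigns⁺ {𝓑s = 𝓒 ∷ 𝓑s} d c m with isDesign? 𝓒 ×-dec isCyclic? 𝓒 | m
... | yes _ | here refl = here refl
... | yes _ | there n   = there (keepDesigns⁺ d c n)
... | no ¬p | here refl with () ← ¬p (d , c)
... | no _  | there n   = keepDesigns⁺ d c n

allDesigns : ∀ v k → List (CyclicDesign v k)
allDesigns v k = keepDesigns (sublists (tuples v k))

allDesigns-complete : ∀ {v k} →
  IsEnumeration (DecSetoid.setoid (designSetoid v k)) (allDesigns v k)
allDesigns-complete {v} {k} (mkCyclicDesign 𝓑 d (φ , c)) =
  Any.map (λ { refl → ≋⇒Isomorphic 𝓑≋𝓒 })
    (keepDesigns⁺ 𝓒-design 𝓒-cyclic (filter∈sublists in𝓑? (tuples v k)))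
  where
  in𝓑? : Decidable (_∈≡ 𝓑)
  in𝓑? B = DecPropositionalMembership._∈?_ (Vec.≡-dec Fin._≟_) B 𝓑

  𝓒 : List (Vec (Fin v) k)
  𝓒 = filter in𝓑? (tuples v k)

  lift : ∀ {𝓓 𝓔 : List (Vec (Fin v) k)} → (∀ {B} → B ∈≡ 𝓓 → B ∈≡ 𝓔) → 𝓓 ⊆ 𝓔
  lift h m with find≡ m
  ... | C , C∈ , B≈C = Any.map (λ { refl → B≈C }) (h C∈)

  𝓒⊆𝓑 : ∀ {B} → B ∈≡ 𝓒 → B ∈≡ 𝓑
  𝓒⊆𝓑 m = proj₂ (∈-filter⁻ in𝓑? {xs = tuples v k} m)

  𝓑≋𝓒 : 𝓑 ≋ 𝓒
  𝓑≋𝓒 = lift (λ m → ∈-filter⁺ in𝓑? (tuples-complete _) m) , lift 𝓒⊆𝓑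

  𝓒-design : IsDesign 𝓒
  𝓒-design = record
    { cycles    = All.tabulate λ m → All.lookup (IsDesign.cycles d) (𝓒⊆𝓑 m)
    ; partition = λ x y x≢y → let B , (m , e) , u = IsDesign.partition d x y x≢y in
        B , (proj₁ 𝓑≋𝓒 m , e) , λ (n , e′) → u (proj₂ 𝓑≋𝓒 n , e′)
    }

  𝓒-cyclic : IsCyclic 𝓒
  𝓒-cyclic = φ , λ z B m →
    relabel-⊆ φ (proj₁ 𝓑≋𝓒) (c z B (relabel-⊆ φ (proj₂ 𝓑≋𝓒) m))

representatives : ∀ v k → List (CyclicDesign v k)
representatives v k = deduplicate (DecSetoid._≟_ (designSetoid v k)) (allDesigns v k)

representatives-complete : ∀ v k →
  IsEnumeration (DecSetoid.setoid (designSetoid v k)) (representatives v k)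
representatives-complete v k =
  Enumerates.deduplicate⁺ (designSetoid v k) allDesigns-complete

representatives-unique : ∀ v k →
  ListUnique.Unique (DecSetoid.setoid (designSetoid v k)) (representatives v k)
representatives-unique v k = DecUnique.deduplicate-! (designSetoid v k) (allDesigns v k)

-- By the two facts above, the number of isomorphism classes.
NC : ℕ → ℕ → ℕ
NC v k = length (representatives v k)

{-# OPTIONS --safe #-}
-- A cyclic (K_v , C_k)-design with v = 2nk + 1 is the set of translates of n base cycles whose
-- nk differences represent every nonzero residue modulo v exactly once up to sign.  Write
-- k = 2p + 3.  The e-th block gets a triple u, w, T with u + w = T + ε, where ε is the parity of
-- p, chosen so that the remaining differences split into np pairs {c , c + 1}.  A triple and p
-- pairs make a closed walk: climb from 0 in unit steps (one pair each), jump by u + w, descend in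
-- unit steps to T, return to 0.  Its vertices are distinct as soon as the pairs come from p bands
-- of increasing size, so in each band the n pairs may be dealt to the n blocks by an arbitrary
-- permutation.  This gives (n!)^p designs.
-- In each of them the cycle through the edge {0 , T} also contains 1 and T + 1, in the same
-- positions.  An isomorphism between two of them that fixes 0 and T therefore fixes 1 and T + 1,
-- hence by translation every vertex, and the two designs coincide.  So an isomorphism class
-- contains at most v² of them, and (n!)^p / v² ≥ 3.35^n / k for n ≥ 9.
module Submission where

open import Defs
open import Data.Fin.Base
  using (Fin; zero; suc; toℕ; fromℕ; fromℕ<; punchIn; punchOut; combine; remQuot; finToFun; funToFin)
open import Data.Fin.Permutation as Perm using (Permutation′; _⟨$⟩ʳ_; _⟨$⟩ˡ_; insert)
import Data.Fin.Properties as Fin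
import Data.Integer.Properties as ℤ
open import Data.List.Base as List using (List; []; _∷_; allFin; cartesianProductWith; length)
open import Data.List.Membership.Propositional using () renaming (_∈_ to _∈≡_; find to find≡)
open import Data.List.Membership.Propositional.Properties
  using (∈-allFin; ∈-cartesianProductWith⁺; ∈-cartesianProductWith⁻)
  renaming (∈-map⁺ to ∈≡-map⁺)
import Data.List.Relation.Unary.All as All
import Data.List.Relation.Unary.Any as Any
import Data.List.Relation.Unary.Any.Properties as Any
open import Data.List.Relation.Unary.Enumerates.Setoid using (IsEnumeration)
open import Data.Nat.Base hiding (parity; _/_)
open import Data.Nat.Divisibility using (_∤_; divides)
open import Data.Nat.DivMod hiding (_/_)
open import Data.Nat.Properties
open import Data.Nat.Tactic.RingSolver using (solve)
open import Data.Product.Base using (∃; ∃-syntax; _×_; _,_; proj₁; proj₂)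
open import Data.Product.Function.NonDependent.Propositional using (_×-↔_)
open import Data.Product.Properties using (,-injectiveˡ; ,-injectiveʳ)
open import Data.Rational.Base as ℚ using (_/_; toℚᵘ)
import Data.Rational.Properties as ℚ
open import Data.Rational.Unnormalised.Base as ℚᵘ using (mkℚᵘ; _≃_; *≤*)
import Data.Rational.Unnormalised.Properties as ℚᵘ
open import Data.Sum.Base as Sum using (_⊎_; inj₁; inj₂; [_,_]′)
open import Data.Vec.Base as Vec using (Vec; lookup; tabulate)
import Data.Vec.Properties as Vec
open import Data.Vec.Relation.Unary.Unique.Propositional using (Unique)
import Data.Vec.Relation.Unary.Unique.Propositional.Properties as Unique
open import Function.Base using (_∘_; id; _$_)
open import Function.Bundles using (_↔_; Inverse; Equivalence)
open import Function.Construct.Composition using (_↔-∘_)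
open import Function.Construct.Identity using (↔-id)
open import Function.Construct.Symmetry using (↔-sym)
open import Function.Definitions using (Injective)
open import Relation.Binary.Bundles using (Setoid; DecSetoid)
open import Relation.Binary.Definitions using (tri<; tri≈; tri>)
open import Relation.Binary.PropositionalEquality
open import Relation.Nullary using (yes; no; contradiction)

-- Addition of residues modulo v.

module _ {w : ℕ} where

  private
    v = suc w

  mod-toℕ : ∀ (x : Fin v) → toℕ x % v ≡ toℕ x
  mod-toℕ x = m<n⇒m%n≡m (Fin.toℕ<n x)

  toℕ-mod : ∀ m → toℕ (m mod v) ≡ m % v
  toℕ-mod m = Fin.toℕ-fromℕ< _

  toℕ-⊕ : ∀ (x y : Fin v) → toℕ (x ⊕ y) ≡ (toℕ x + toℕ y) % v
  toℕ-⊕ x y = toℕ-mod (toℕ x + toℕ y)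

  %-absorbˡ : ∀ a b → (a % v + b) % v ≡ (a + b) % v
  %-absorbˡ a b = begin
    (a % v + b) % v           ≡⟨ %-distribˡ-+ (a % v) b v ⟩
    (a % v % v + b % v) % v   ≡⟨ cong (λ c → (c + b % v) % v) (m%n%n≡m%n a v) ⟩
    (a % v + b % v) % v       ≡⟨ %-distribˡ-+ a b v ⟨
    (a + b) % v               ∎
    where open ≡-Reasoning

  %-absorbʳ : ∀ a b → (a + b % v) % v ≡ (a + b) % v
  %-absorbʳ a b = trans (cong (_% v) (+-comm a (b % v)))
    (trans (%-absorbˡ b a) (cong (_% v) (+-comm b a)))

  ⊕-comm : ∀ (x y : Fin v) → x ⊕ y ≡ y ⊕ x
  ⊕-comm x y = cong (_mod v) (+-comm (toℕ x) (toℕ y))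

  ⊕-assoc : ∀ (x y z : Fin v) → (x ⊕ y) ⊕ z ≡ x ⊕ (y ⊕ z)
  ⊕-assoc x y z = Fin.toℕ-injective $ begin
    toℕ ((x ⊕ y) ⊕ z)                    ≡⟨ toℕ-⊕ (x ⊕ y) z ⟩
    (toℕ (x ⊕ y) + toℕ z) % v            ≡⟨ cong (λ c → (c + toℕ z) % v) (toℕ-⊕ x y) ⟩
    ((toℕ x + toℕ y) % v + toℕ z) % v    ≡⟨ %-absorbˡ (toℕ x + toℕ y) (toℕ z) ⟩
    (toℕ x + toℕ y + toℕ z) % v          ≡⟨ cong (_% v) (+-assoc (toℕ x) (toℕ y) (toℕ z)) ⟩
    (toℕ x + (toℕ y + toℕ z)) % v        ≡⟨ %-absorbʳ (toℕ x) (toℕ y + toℕ z) ⟨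
    (toℕ x + (toℕ y + toℕ z) % v) % v    ≡⟨ cong (λ c → (toℕ x + c) % v) (toℕ-⊕ y z) ⟨
    (toℕ x + toℕ (y ⊕ z)) % v            ≡⟨ toℕ-⊕ x (y ⊕ z) ⟨
    toℕ (x ⊕ (y ⊕ z))                    ∎
    where open ≡-Reasoning

  ⊕-identityʳ : ∀ (x : Fin v) → x ⊕ zero ≡ x
  ⊕-identityʳ x = Fin.toℕ-injective
    (trans (toℕ-⊕ x zero) (trans (cong (_% v) (+-identityʳ (toℕ x))) (mod-toℕ x)))

  ⊕-difference : ∀ (x y : Fin v) → ∃[ z ] x ⊕ z ≡ y
  ⊕-difference x y = z , Fin.toℕ-injective (begin
    toℕ (x ⊕ z)                                ≡⟨ toℕ-⊕ x z ⟩
    (toℕ x + toℕ z) % v                        ≡⟨ cong (λ c → (toℕ x + c) % v) (toℕ-mod (v ∸ toℕ x + toℕ y)) ⟩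
    (toℕ x + (v ∸ toℕ x + toℕ y) % v) % v      ≡⟨ %-absorbʳ (toℕ x) (v ∸ toℕ x + toℕ y) ⟩
    (toℕ x + (v ∸ toℕ x + toℕ y)) % v          ≡⟨ cong (_% v) (+-assoc (toℕ x) (v ∸ toℕ x) (toℕ y)) ⟨
    (toℕ x + (v ∸ toℕ x) + toℕ y) % v          ≡⟨ cong (λ c → (c + toℕ y) % v) (m+[n∸m]≡n (Fin.toℕ≤n x)) ⟩
    (v + toℕ y) % v                            ≡⟨ cong (_% v) (+-comm v (toℕ y)) ⟩
    (toℕ y + v) % v                            ≡⟨ [m+n]%n≡m%n (toℕ y) v ⟩
    toℕ y % v                                  ≡⟨ mod-toℕ y ⟩
    toℕ y                                      ∎)
    where
    open ≡-Reasoning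
    z : Fin v
    z = (v ∸ toℕ x + toℕ y) mod v

  ⊕-cancelʳ : ∀ (z : Fin v) {x y} → x ⊕ z ≡ y ⊕ z → x ≡ y
  ⊕-cancelʳ z {x} {y} eq with ⊕-difference z zero
  ... | z⁻ , z⊕z⁻ = begin
    x                ≡⟨ undo x ⟨
    (x ⊕ z) ⊕ z⁻     ≡⟨ cong (_⊕ z⁻) eq ⟩
    (y ⊕ z) ⊕ z⁻     ≡⟨ undo y ⟩
    y                ∎
    where
    open ≡-Reasoning
    undo : ∀ x → (x ⊕ z) ⊕ z⁻ ≡ x
    undo x = trans (⊕-assoc x z z⁻) (trans (cong (x ⊕_) z⊕z⁻) (⊕-identityʳ x))

-- Pigeonhole on finite sets.

-- A missed value could be punched out of the codomain, leaving an injection of `suc N` elements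
-- into `N`.
injective⇒surjective : ∀ {N} (f : Fin N → Fin N) → Injective _≡_ _≡_ f → ∀ y → ∃[ x ] f x ≡ y
injective⇒surjective {suc N} f f-inj y with Fin.any? (λ x → f x Fin.≟ y)
... | yes hit = hit
... | no miss = contradiction (Fin.injective⇒≤ punched-injective) (n≮n N)
  where
  y≢f : ∀ x → y ≢ f x
  y≢f x y≡fx = miss (x , sym y≡fx)

  punched-injective : Injective _≡_ _≡_ (λ x → punchOut (y≢f x))
  punched-injective {x} {x′} = f-inj ∘ Fin.punchOut-injective (y≢f x) (y≢f x′)

module _ {A : Set} {N : ℕ} (A↔ : A ↔ Fin N) where
  open Inverse A↔

  ↔-to-injective : Injective _≡_ _≡_ to
  ↔-to-injective {x} {y} eq =
    trans (sym (strictlyInverseʳ x)) (trans (cong from eq) (strictlyInverseʳ y))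

  ↔-from-injective : Injective _≡_ _≡_ from
  ↔-from-injective {x} {y} eq =
    trans (sym (strictlyInverseˡ x)) (trans (cong to eq) (strictlyInverseˡ y))

equinumerous-injective⇒surjective : ∀ {A B : Set} {N} → A ↔ Fin N → B ↔ Fin N → (g : B → A) →
  Injective _≡_ _≡_ g → ∀ a → ∃[ b ] g b ≡ a
equinumerous-injective⇒surjective A↔ B↔ g g-inj a =
  let x , eq = injective⇒surjective (Inverse.to A↔ ∘ g ∘ Inverse.from B↔)
                 (↔-from-injective B↔ ∘ g-inj ∘ ↔-to-injective A↔) (Inverse.to A↔ a)
  in Inverse.from B↔ x , ↔-to-injective A↔ eq

-- Cyclic designs from difference families.

module DifferenceFamily {w n k : ℕ} (size : w ≡ n * (k * 2))
  (base : Fin n → Vec (Fin (suc w)) k)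
  (base-unique : ∀ e → Unique (base e))
  (covers : ∀ x y → x ≢ y → ∃[ e ] ∃[ z ] Edge (translate z (base e)) x y)
  where

  private
    v = suc w
    open Setoid (cycleSetoid v k) using ()
      renaming (sym to ≈-sym; trans to ≈-trans; reflexive to ≈-reflexive)

  develop : List (Vec (Fin v) k)
  develop = cartesianProductWith (λ e z → translate z (base e)) (allFin n) (allFin v)

  ∈≡-develop : ∀ e z → translate z (base e) ∈≡ develop
  ∈≡-develop e z = ∈-cartesianProductWith⁺ _ (∈-allFin e) (∈-allFin z)

  ∈-develop : ∀ e z → translate z (base e) ∈ develop
  ∈-develop e z = ∈≡⇒∈ (∈≡-develop e z)

  develop-∈≡ : ∀ {B} → B ∈≡ develop → ∃[ e ] ∃[ z ] B ≡ translate z (base e)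
  develop-∈≡ m = let e , z , _ , _ , eq = ∈-cartesianProductWith⁻ _ (allFin n) (allFin v) m in e , z , eq

  develop-∈ : ∀ {B} → B ∈ develop → ∃[ e ] ∃[ z ] B ≈ translate z (base e)
  develop-∈ m with find≡ m
  ... | C , C∈ , B≈C with develop-∈≡ C∈
  ...   | e , z , refl = e , z , B≈C

  private
    -- The data of one directed edge of the development: a block, a place in it, an orientation and
    -- a translation.
    Position : Set
    Position = Fin n × Fin k × Fin 2 × Fin v

    orient : Fin 2 → Fin v × Fin v → Fin v × Fin v
    orient zero       (x , y) = x , y
    orient (suc zero) (x , y) = y , x

    arc : Position → Fin v × Fin v
    arc (e , i , s , z) = orient s (lookup (base e) i ⊕ z , lookup (base e) (next i) ⊕ z)

    locate : ∀ {x y} e z → Edge (translate z (base e)) x y →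
             ∃[ i ] ∃[ s ] arc (e , i , s , z) ≡ (x , y)
    locate e z (i , inj₁ (refl , refl)) = i , zero ,
      sym (cong₂ _,_ (Vec.lookup-map i (_⊕ z) (base e)) (Vec.lookup-map (next i) (_⊕ z) (base e)))
    locate e z (i , inj₂ (refl , refl)) = i , suc zero ,
      sym (cong₂ _,_ (Vec.lookup-map (next i) (_⊕ z) (base e)) (Vec.lookup-map i (_⊕ z) (base e)))

    -- `Fin v × Fin w` codes the ordered pairs of distinct vertices, since `punchIn x` runs over all
    -- vertices except `x`.
    x≢punchIn : ∀ (p : Fin v × Fin w) → proj₁ p ≢ punchIn (proj₁ p) (proj₂ p)
    x≢punchIn (x , y) = Fin.punchInᵢ≢i x y ∘ sym

    point : Fin v × Fin w → Position
    point p@(x , y) =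
      let e , z , E = covers x (punchIn x y) (x≢punchIn p)
          i , s , _ = locate e z E
      in e , i , s , z

    arc-point : ∀ p → arc (point p) ≡ (proj₁ p , punchIn (proj₁ p) (proj₂ p))
    arc-point p@(x , y) =
      let e , z , E = covers x (punchIn x y) (x≢punchIn p)
          i , s , eq = locate e z E
      in eq

    punched-injective : ∀ (p q : Fin v × Fin w) →
      (proj₁ p , punchIn (proj₁ p) (proj₂ p)) ≡ (proj₁ q , punchIn (proj₁ q) (proj₂ q)) → p ≡ q
    punched-injective (x , y) (x′ , y′) eq with ,-injectiveˡ eq
    ... | refl = cong (x ,_) (Fin.punchIn-injective x y y′ (,-injectiveʳ eq))

    point-injective : Injective _≡_ _≡_ point
    point-injective {p} {q} eq = punched-injective p q
      (trans (sym (arc-point p)) (trans (cong arc eq) (arc-point q)))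

    Position↔Fin : Position ↔ Fin (v * w)
    Position↔Fin = subst (λ N → Position ↔ Fin N) count
      (↔-sym Fin.*↔× ↔-∘ (↔-id _ ×-↔ (↔-sym Fin.*↔× ↔-∘ (↔-id _ ×-↔ ↔-sym Fin.*↔×))))
      where
      open ≡-Reasoning
      count : n * (k * (2 * v)) ≡ v * w
      count = begin
        n * (k * (2 * v))   ≡⟨ cong (n *_) (*-assoc k 2 v) ⟨
        n * (k * 2 * v)     ≡⟨ *-assoc n (k * 2) v ⟨
        n * (k * 2) * v     ≡⟨ cong (_* v) size ⟨
        w * v               ≡⟨ *-comm w v ⟩
        v * w               ∎

    -- Position and the set of ordered pairs x ≢ y have the same size, so covering every
    -- pair leaves no room for covering one twice.
    arc-injective : Injective _≡_ _≡_ arc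
    arc-injective {a} {a′} eq =
      let onto = equinumerous-injective⇒surjective Position↔Fin (↔-sym Fin.*↔×) point point-injective
          p , pa = onto a
          p′ , pa′ = onto a′
          arcs = trans (cong arc pa) (trans eq (sym (cong arc pa′)))
      in trans (sym pa) (trans (cong point (punched-injective p p′
           (trans (sym (arc-point p)) (trans arcs (arc-point p′))))) pa′)

  edge-unique : ∀ {x y} e z e′ z′ → Edge (translate z (base e)) x y →
                Edge (translate z′ (base e′)) x y → e ≡ e′ × z ≡ z′
  edge-unique e z e′ z′ E E′ =
    let i , s , eq = locate e z E
        i′ , s′ , eq′ = locate e′ z′ E′
        same = arc-injective {e , i , s , z} {e′ , i′ , s′ , z′} (trans eq (sym eq′))
    in cong proj₁ same , cong (λ a → proj₂ (proj₂ (proj₂ a))) same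

  design : IsDesign develop
  design = record
    { cycles    = All.tabulate unique
    ; partition = λ x y x≢y →
        let e , z , E = covers x y x≢y
        in translate z (base e) , (∈-develop e z , E) , only e z E
    }
    where
    unique : ∀ {B} → B ∈≡ develop → Unique B
    unique m with develop-∈≡ m
    ... | e , z , refl = Unique.map⁺ (⊕-cancelʳ z) (base-unique e)

    only : ∀ {x y} e z → Edge (translate z (base e)) x y → ∀ {C} →
           C ∈ develop × Edge C x y → translate z (base e) ≈ C
    only {x} {y} e z E (m , F) =
      let e′ , z′ , C≈ = develop-∈ m
          e≡e′ , z≡z′ = edge-unique e z e′ z′ E (Equivalence.to (sameEdges C≈ x y) F)
      in ≈-trans (≈-reflexive (cong₂ (λ z e → translate z (base e)) z≡z′ e≡e′)) (≈-sym C≈)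

  translate-translate : ∀ z z′ (B : Vec (Fin v) k) →
                        translate z (translate z′ B) ≡ translate (z′ ⊕ z) B
  translate-translate z z′ B =
    trans (sym (Vec.map-∘ _ _ B)) (Vec.map-cong (λ x → ⊕-assoc x z′ z) B)

  cyclic : IsCyclic develop
  cyclic = Perm.id , subst TranslationInvariant
    (sym (relabel-id {σ = Perm.id} (λ _ → refl) develop)) invariant
    where
    invariant : TranslationInvariant develop
    invariant z B m with develop-∈ m
    ... | e , z′ , B≈ = ∈-resp (≈-sym (≈-trans (map-≈ (_⊕ z) B≈)
      (≈-reflexive (translate-translate z z′ (base e))))) (∈-develop e (z′ ⊕ z))

  cyclicDesign : CyclicDesign v k
  cyclicDesign = mkCyclicDesign develop design cyclic

-- The cyclic successor and the rigidity of cycles.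

module _ {m : ℕ} where

  private
    last : Fin (suc m)
    last = fromℕ m

  toℕ-next : ∀ (i : Fin (suc m)) → toℕ (next i) ≡ suc (toℕ i) % suc m
  toℕ-next i = Fin.toℕ-fromℕ< _

  next-suc : ∀ {i : Fin (suc m)} → toℕ i < m → toℕ (next i) ≡ suc (toℕ i)
  next-suc {i} i<m = trans (toℕ-next i) (m<n⇒m%n≡m (s≤s i<m))

  next-last : next last ≡ zero
  next-last = Fin.toℕ-injective (trans (toℕ-next last)
    (trans (cong (λ j → suc j % suc m) (Fin.toℕ-fromℕ m)) (n%n≡0 (suc m))))

  -- Turns the cyclic successor into a translation, so that cancellation in the group gives its
  -- injectivity.
  next≗⊕1 : ∀ (i : Fin (suc m)) → next i ≡ i ⊕ (1 mod suc m)
  next≗⊕1 i = Fin.toℕ-injective (trans (toℕ-next i) (sym (trans (toℕ-⊕ i (1 mod suc m))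
    (trans (cong (λ c → (toℕ i + c) % suc m) (toℕ-mod 1))
    (trans (%-absorbʳ (toℕ i) 1) (cong (_% suc m) (+-comm (toℕ i) 1)))))))

  next-injective : ∀ {i j : Fin (suc m)} → next i ≡ next j → i ≡ j
  next-injective {i} {j} eq = ⊕-cancelʳ (1 mod suc m)
    (trans (sym (next≗⊕1 i)) (trans eq (next≗⊕1 j)))

  -- Cancelling `i` would leave 2 = 0 modulo `suc m`, which fails on a cycle with at least three
  -- vertices.
  next²≢id : 2 ≤ m → ∀ (i : Fin (suc m)) → next (next i) ≢ i
  next²≢id 2≤m i eq = absurd (trans (sym toℕ-2) (cong toℕ 2≡0))
    where
    one = 1 mod suc m
    toℕ-1 : toℕ one ≡ 1
    toℕ-1 = trans (toℕ-mod 1) (m<n⇒m%n≡m (s≤s (≤-trans (s≤s z≤n) 2≤m)))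
    2≡0 : one ⊕ one ≡ zero
    2≡0 = ⊕-cancelʳ i (trans (⊕-comm (one ⊕ one) i) (trans (sym (⊕-assoc i one one))
      (trans (sym (trans (next≗⊕1 (next i)) (cong (_⊕ one) (next≗⊕1 i))))
      (trans eq (sym (trans (⊕-comm zero i) (⊕-identityʳ i)))))))
    toℕ-2 : toℕ (one ⊕ one) ≡ 2
    toℕ-2 = trans (toℕ-⊕ one one)
      (trans (cong (λ c → (c + c) % suc m) toℕ-1) (m<n⇒m%n≡m (s≤s 2≤m)))
    absurd : 2 ≢ 0
    absurd ()

  -- Walking along the cycle from the common closing edge: at each vertex the two
  -- neighbours are determined by the edge set, and one of them has just been visited.
  cycle-rigid : 2 ≤ m → ∀ {v} {B C : Vec (Fin v) (suc m)} → Unique B → Unique C → B ≈ C →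
                lookup B last ≡ lookup C last → lookup B zero ≡ lookup C zero →
                ∀ i → lookup B i ≡ lookup C i
  cycle-rigid 2≤m {v} {B} {C} B! C! B≈C last≡ zero≡ i = proj₁ (agree (toℕ i) i refl)
    where

    step : ∀ i → lookup B i ≡ lookup C i → lookup B (next i) ≡ lookup C (next i) →
           lookup B (next (next i)) ≡ lookup C (next (next i))
    step i eq eq′ with Equivalence.to (sameEdges B≈C (lookup B (next i)) (lookup B (next (next i))))
                         (next i , inj₁ (refl , refl))
    ... | j , inj₁ (p , q) with Unique.lookup-injective C! (next i) j (trans (sym eq′) p)
    ...   | refl = q
    step i eq eq′ | j , inj₂ (p , q)
      with next-injective (Unique.lookup-injective C! (next i) (next j) (trans (sym eq′) q))
    ...   | refl = contradiction (Unique.lookup-injective B! (next (next i)) i (trans p (sym eq)))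
                                 (next²≢id 2≤m i)

    Agree : Fin (suc m) → Set
    Agree i = lookup B i ≡ lookup C i × lookup B (next i) ≡ lookup C (next i)

    agree-last : Agree last
    agree-last = last≡ , subst (λ j → lookup B j ≡ lookup C j) (sym next-last) zero≡

    advance : ∀ i → Agree i → Agree (next i)
    advance i (eq , eq′) = eq′ , step i eq eq′

    agree : ∀ j (i : Fin (suc m)) → toℕ i ≡ j → Agree i
    agree zero zero _ = subst Agree next-last (advance last agree-last)
    agree (suc j) i i≡ = subst Agree
      (Fin.toℕ-injective (trans (next-suc {i = i′} i′<m) (trans (cong suc toℕi′) (sym i≡))))
      (advance i′ (agree j i′ toℕi′))
      where
      j<m : j < m
      j<m = ≤-pred (subst (_< suc m) i≡ (Fin.toℕ<n i))
      i′ : Fin (suc m)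
      i′ = j mod suc m
      toℕi′ : toℕ i′ ≡ j
      toℕi′ = trans (toℕ-mod j) (m<n⇒m%n≡m (≤-trans j<m (n≤1+n m)))
      i′<m : toℕ i′ < m
      i′<m = subst (_< m) (sym toℕi′) j<m

-- Interleaved and spliced sequences.

interleave : ∀ {A : Set} → (ℕ → A) → (ℕ → A) → ℕ → A
interleave f g zero          = f zero
interleave f g (suc zero)    = g zero
interleave f g (suc (suc i)) = interleave (f ∘ suc) (g ∘ suc) i

interleave-even : ∀ {A : Set} (f g : ℕ → A) j → interleave f g (j * 2) ≡ f j
interleave-even f g zero    = refl
interleave-even f g (suc j) = interleave-even (f ∘ suc) (g ∘ suc) j

interleave-odd : ∀ {A : Set} (f g : ℕ → A) j → interleave f g (suc (j * 2)) ≡ g j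
interleave-odd f g zero    = refl
interleave-odd f g (suc j) = interleave-odd (f ∘ suc) (g ∘ suc) j

data Parity : ℕ → Set where
  even : ∀ j → Parity (j * 2)
  odd  : ∀ j → Parity (suc (j * 2))

parity : ∀ i → Parity i
parity zero    = even zero
parity (suc i) with parity i
... | even j = odd j
... | odd j  = even (suc j)

splice : ∀ {A : Set} → ℕ → (ℕ → A) → (ℕ → A) → ℕ → A
splice zero    f g j       = g j
splice (suc m) f g zero    = f zero
splice (suc m) f g (suc j) = splice m (f ∘ suc) g j

splice-before : ∀ {A : Set} {m j} (f g : ℕ → A) → j < m → splice m f g j ≡ f j
splice-before {m = suc m} {zero}  f g j<m       = refl
splice-before {m = suc m} {suc j} f g (s≤s j<m) = splice-before (f ∘ suc) g j<m

splice-after : ∀ {A : Set} m (f g : ℕ → A) j → splice m f g (m + j) ≡ g j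
splice-after zero    f g j = refl
splice-after (suc m) f g j = splice-after m (f ∘ suc) g j

data Split (m : ℕ) : ℕ → Set where
  before : ∀ {j} → j < m → Split m j
  after  : ∀ s → Split m (m + s)

split : ∀ m j → Split m j
split m j with j <? m
... | yes j<m = before j<m
... | no  j≮m = subst (Split m) (m+[n∸m]≡n (≮⇒≥ j≮m)) (after (j ∸ m))

increasing⇒injective : ∀ {m} (f : ℕ → ℕ) → (∀ {i j} → i < j → j < m → f i < f j) →
  ∀ {i j} → i < m → j < m → f i ≡ f j → i ≡ j
increasing⇒injective f f-inc {i} {j} i<m j<m eq with <-cmp i j
... | tri< i<j _ _ = contradiction eq (<⇒≢ (f-inc i<j j<m))
... | tri≈ _ i≡j _ = i≡j
... | tri> _ _ j<i = contradiction (sym eq) (<⇒≢ (f-inc j<i i<m))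

decreasing⇒injective : ∀ {m} (f : ℕ → ℕ) → (∀ {i j} → i < j → j < m → f j < f i) →
  ∀ {i j} → i < m → j < m → f i ≡ f j → i ≡ j
decreasing⇒injective f f-dec {i} {j} i<m j<m eq with <-cmp i j
... | tri< i<j _ _ = contradiction (sym eq) (<⇒≢ (f-dec i<j j<m))
... | tri≈ _ i≡j _ = i≡j
... | tri> _ _ j<i = contradiction eq (<⇒≢ (f-dec j<i i<m))

-- The zigzag walk and the distinctness of its vertices.

-- The closed walk of odd length 2(M + D + 1) + 1
--   0, up 0, 1, up 1, …, M, μ, T + D, dn 0, T + (D − 1), dn 1, …, T,
-- whose vertices satisfy 0 < … < M < μ < up _ < T < … < T + D < dn _.
module Zigzag (M D μ T : ℕ) (up dn : ℕ → ℕ) where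

  H : ℕ
  H = suc (M + D)

  hub rim vertex : ℕ → ℕ
  hub = splice (suc M) id (λ s → T + (D ∸ s))
  rim = splice M up λ { zero → μ ; (suc s) → dn s }
  vertex = interleave hub rim

  hub-low : ∀ {j} → j ≤ M → hub j ≡ j
  hub-low j≤M = splice-before id _ (s≤s j≤M)

  hub-high : ∀ s → hub (suc M + s) ≡ T + (D ∸ s)
  hub-high = splice-after (suc M) id _

  rim-up : ∀ {j} → j < M → rim j ≡ up j
  rim-up = splice-before up _

  rim-mid : rim M ≡ μ
  rim-mid = trans (cong rim (sym (+-identityʳ M))) (splice-after M up _ 0)

  rim-dn : ∀ s → rim (suc M + s) ≡ dn s
  rim-dn s = trans (cong rim (sym (+-suc M s))) (splice-after M up _ (suc s))

  hub-last : hub H ≡ T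
  hub-last = trans (hub-high D) (trans (cong (T +_) (n∸n≡0 D)) (+-identityʳ T))

  module Distinct {v} (M<μ : M < μ) (μ<T : μ < T)
    (μ<up : ∀ {j} → j < M → μ < up j) (up<T : ∀ {j} → j < M → up j < T)
    (T+D<v : T + D < v) (T+D<dn : ∀ {s} → s < D → T + D < dn s) (dn<v : ∀ {s} → s < D → dn s < v)
    (up-dec : ∀ {i j} → i < j → j < M → up j < up i)
    (dn-inc : ∀ {i j} → i < j → j < D → dn i < dn j)
    where

    -- The graph of `rim` as a view, with one constructor for each range of values. A coincidence of
    -- two values splits into cases, settled by monotonicity within a range and by the order of the
    -- ranges otherwise.
    data Rim : ℕ → ℕ → Set where
      up-rim  : ∀ {j} → j < M → Rim j (up j)
      mid-rim : Rim M μ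
      dn-rim  : ∀ {s} → s < D → Rim (suc M + s) (dn s)

    rim-view : ∀ {j} → j < H → Rim j (rim j)
    rim-view {j} j<H with split M j
    ... | before j<M    = subst (Rim j) (sym (rim-up j<M)) (up-rim j<M)
    ... | after zero    rewrite +-identityʳ M = subst (Rim M) (sym rim-mid) mid-rim
    ... | after (suc s) rewrite +-suc M s =
      subst (Rim (suc M + s)) (sym (rim-dn s)) (dn-rim (+-cancelˡ-< (suc M) s D j<H))

    data Hub : ℕ → ℕ → Set where
      low-hub  : ∀ {j} → j ≤ M → Hub j j
      high-hub : ∀ {s} → s ≤ D → Hub (suc M + s) (T + (D ∸ s))

    hub-view : ∀ {j} → j ≤ H → Hub j (hub j)
    hub-view {j} j≤H with split (suc M) j
    ... | before (s≤s j≤M) = subst (Hub j) (sym (hub-low j≤M)) (low-hub j≤M)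
    ... | after s = subst (Hub (suc M + s)) (sym (hub-high s)) (high-hub (+-cancelˡ-≤ (suc M) s D j≤H))

    M<T : M < T
    M<T = <-trans M<μ μ<T

    μ<T+ : ∀ s → μ < T + s
    μ<T+ s = <-≤-trans μ<T (m≤m+n T s)

    T+[D∸s]<dn : ∀ {s s′} → s′ < D → T + (D ∸ s) < dn s′
    T+[D∸s]<dn {s} s′<D = ≤-<-trans (+-monoʳ-≤ T (m∸n≤m D s)) (T+D<dn s′<D)

    μ<dn : ∀ {s} → s < D → μ < dn s
    μ<dn s<D = <-trans (μ<T+ D) (T+D<dn s<D)

    up<dn : ∀ {j s} → j < M → s < D → up j < dn s
    up<dn j<M s<D = <-trans (up<T j<M) (≤-<-trans (m≤m+n T D) (T+D<dn s<D))

    Rim-injective : ∀ {i j x y} → Rim i x → Rim j y → x ≡ y → i ≡ j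
    Rim-injective (up-rim i<M) (up-rim j<M) eq = decreasing⇒injective up up-dec i<M j<M eq
    Rim-injective (up-rim i<M) mid-rim      eq = contradiction (sym eq) (<⇒≢ (μ<up i<M))
    Rim-injective (up-rim i<M) (dn-rim s<D) eq = contradiction eq (<⇒≢ (up<dn i<M s<D))
    Rim-injective mid-rim      (up-rim j<M) eq = contradiction eq (<⇒≢ (μ<up j<M))
    Rim-injective mid-rim      mid-rim      eq = refl
    Rim-injective mid-rim      (dn-rim s<D) eq = contradiction eq (<⇒≢ (μ<dn s<D))
    Rim-injective (dn-rim s<D) (up-rim j<M) eq = contradiction (sym eq) (<⇒≢ (up<dn j<M s<D))
    Rim-injective (dn-rim s<D) mid-rim      eq = contradiction (sym eq) (<⇒≢ (μ<dn s<D))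
    Rim-injective (dn-rim s<D) (dn-rim t<D) eq =
      cong (suc M +_) (increasing⇒injective dn dn-inc s<D t<D eq)

    Hub-injective : ∀ {i j x y} → Hub i x → Hub j y → x ≡ y → i ≡ j
    Hub-injective (low-hub _)        (low-hub _)  eq = eq
    Hub-injective (low-hub i≤M) (high-hub {s} _)  eq =
      contradiction eq (<⇒≢ (≤-<-trans i≤M (<-≤-trans M<T (m≤m+n T (D ∸ s)))))
    Hub-injective (high-hub {s} _) (low-hub j≤M)  eq =
      contradiction (sym eq) (<⇒≢ (≤-<-trans j≤M (<-≤-trans M<T (m≤m+n T (D ∸ s)))))
    Hub-injective (high-hub s≤D) (high-hub t≤D)   eq =
      cong (suc M +_) (∸-cancelˡ-≡ s≤D t≤D (+-cancelˡ-≡ T _ _ eq))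

    Hub≢Rim : ∀ {i j x y} → Hub i x → Rim j y → x ≢ y
    Hub≢Rim (low-hub i≤M)     (up-rim j<M)     = <⇒≢ (≤-<-trans i≤M (<-trans M<μ (μ<up j<M)))
    Hub≢Rim (low-hub i≤M)     mid-rim          = <⇒≢ (≤-<-trans i≤M M<μ)
    Hub≢Rim (low-hub i≤M)     (dn-rim s<D)     = <⇒≢ (≤-<-trans i≤M (<-trans M<μ (μ<dn s<D)))
    Hub≢Rim (high-hub {s} _)  (up-rim j<M)     = >⇒≢ (<-≤-trans (up<T j<M) (m≤m+n T (D ∸ s)))
    Hub≢Rim (high-hub {s} _)  mid-rim          = >⇒≢ (μ<T+ (D ∸ s))
    Hub≢Rim (high-hub {s} _)  (dn-rim {t} t<D) = <⇒≢ (T+[D∸s]<dn {s} t<D)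

    Rim<v : ∀ {i x} → Rim i x → x < v
    Rim<v (up-rim i<M) = <-trans (up<T i<M) (≤-<-trans (m≤m+n T D) T+D<v)
    Rim<v mid-rim      = <-trans (μ<T+ D) T+D<v
    Rim<v (dn-rim s<D) = dn<v s<D

    Hub<v : ∀ {i x} → Hub i x → x < v
    Hub<v (low-hub i≤M)    = ≤-<-trans i≤M (<-trans M<T (≤-<-trans (m≤m+n T D) T+D<v))
    Hub<v (high-hub {s} _) = ≤-<-trans (+-monoʳ-≤ T (m∸n≤m D s)) T+D<v

    data Vertex : ℕ → ℕ → Set where
      hub-vertex : ∀ {j x} → Hub j x → Vertex (j * 2) x
      rim-vertex : ∀ {j x} → Rim j x → Vertex (suc (j * 2)) x

    vertex-view : ∀ {i} → i < suc (H * 2) → Vertex i (vertex i)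
    vertex-view {i} (s≤s i≤) with parity i
    ... | even j = subst (Vertex (j * 2)) (sym (interleave-even hub rim j))
                     (hub-vertex (hub-view (*-cancelʳ-≤ j H 2 i≤)))
    ... | odd j  = subst (Vertex (suc (j * 2))) (sym (interleave-odd hub rim j))
                     (rim-vertex (rim-view (*-cancelʳ-< 2 j H i≤)))

    vertex-injective : ∀ {i j} → i < suc (H * 2) → j < suc (H * 2) → vertex i ≡ vertex j → i ≡ j
    vertex-injective i< j< = aux (vertex-view i<) (vertex-view j<)
      where
      aux : ∀ {i j x y} → Vertex i x → Vertex j y → x ≡ y → i ≡ j
      aux (hub-vertex h) (hub-vertex h′) eq = cong (_* 2) (Hub-injective h h′ eq)
      aux (hub-vertex h) (rim-vertex r)  eq = contradiction eq (Hub≢Rim h r)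
      aux (rim-vertex r) (hub-vertex h)  eq = contradiction (sym eq) (Hub≢Rim h r)
      aux (rim-vertex r) (rim-vertex r′) eq = cong (λ j → suc (j * 2)) (Rim-injective r r′ eq)

    vertex<v : ∀ {i} → i < suc (H * 2) → vertex i < v
    vertex<v i< with vertex-view i<
    ... | x = aux x
      where
      aux : ∀ {i x} → Vertex i x → x < v
      aux (hub-vertex h) = Hub<v h
      aux (rim-vertex r) = Rim<v r

-- Linear inequalities that separate the ranges of the walk.

infixr 5 _∧≤_

-- Adds up hypotheses for a certificate; a repeated hypothesis enters with a higher coefficient.
_∧≤_ : ∀ {A B A′ B′} → A ≤ B → A′ ≤ B′ → A + A′ ≤ B + B′
_∧≤_ = +-mono-≤

-- A linear-arithmetic certificate: L ≤ R follows from the sum A ≤ B of hypotheses with slack s.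
by-slack : ∀ {L R A B} s → A ≤ B → L + B + s ≡ R + A → L ≤ R
by-slack {L} {R} {A} {B} s A≤B eq = +-cancelʳ-≤ B L R (begin
  L + B       ≤⟨ m≤m+n (L + B) s ⟩
  L + B + s   ≡⟨ eq ⟩
  R + A       ≤⟨ +-monoʳ-≤ R A≤B ⟩
  R + B       ∎)
  where open ≤-Reasoning

-- The separations that `Zigzag.Distinct` asks for, with `e` the number of the block and `q` the
-- place of a pair in its band. In `μ<up` and `up<T` the band is `D + r`; in `T+D<dn` and `dn<v` it
-- is `s`.
module Inequalities {n M D γ ε a e : ℕ} (1≤n : 1 ≤ n) (e<n : e < n) (1≤D : 1 ≤ D)
  (ε≤1 : ε ≤ 1) (1≤γ : 1 ≤ γ) (γ≤2 : γ ≤ 2) (balance : 2 * a + 2 ≡ n + γ + ε) where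

  private
    balance≤ : 2 * a + 2 ≤ n + γ + ε
    balance≤ = ≤-reflexive balance

    -- Products with `n` are atoms for the linear certificates, so bounds such as this one supply
    -- what is nonlinear.
    scale : ∀ m → m ≤ n * m
    scale m = subst (_≤ n * m) (*-identityˡ m) (*-monoˡ-≤ m 1≤n)

    n≤nD : n ≤ n * D
    n≤nD = subst (_≤ n * D) (*-identityʳ n) (*-monoʳ-≤ n 1≤D)

  μ<T : M + suc (2 * a + e) < 2 * (n * (D + M)) + 2 * n + γ + 2 * e
  μ<T = by-slack (2 * (n * D) + n * M + e) (balance≤ ∧≤ scale M ∧≤ ≤-trans ε≤1 1≤n)
    (solve (n ∷ M ∷ D ∷ γ ∷ ε ∷ a ∷ e ∷ []))

  T+D<v : 2 * (n * (D + M)) + 2 * n + γ + 2 * e + D < suc (n * (suc (suc (M + D) * 2) * 2))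
  T+D<v = by-slack (n * D + 2 * (n * M) + 2 * n) (e<n ∧≤ e<n ∧≤ γ≤2 ∧≤ scale D)
    (solve (n ∷ M ∷ D ∷ γ ∷ e ∷ []))

  μ<up : ∀ {j r q} → suc j + r ≡ M →
         M + suc (2 * a + e) < j + suc (suc (2 * (n * (D + r) + q)) + n)
  μ<up {j} {r} {q} M≡ = by-slack (n * r + 2 * q)
    (≤-reflexive (sym M≡) ∧≤ balance≤ ∧≤ γ≤2 ∧≤ ε≤1 ∧≤ e<n ∧≤ scale r ∧≤ n≤nD ∧≤ ≤-trans 1≤n n≤nD)
    (solve (n ∷ M ∷ D ∷ γ ∷ ε ∷ a ∷ e ∷ j ∷ r ∷ q ∷ []))

  up<T : ∀ {j r q} → suc j + r ≡ M → q < n →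
         j + suc (suc (2 * (n * (D + r) + q)) + n) < 2 * (n * (D + M)) + 2 * n + γ + 2 * e
  up<T {j} {r} {q} M≡ q<n = by-slack (2 * e + n * j + n)
    (nM≤ ∧≤ nM≤ ∧≤ q<n ∧≤ q<n ∧≤ scale j ∧≤ 1≤γ)
    (solve (n ∷ M ∷ D ∷ γ ∷ e ∷ j ∷ r ∷ q ∷ []))
    where
    nM≤ : n * (suc j + r) ≤ n * M
    nM≤ = ≤-reflexive (cong (n *_) M≡)

  T+D<dn : ∀ {T s r q c} → s + r ≡ D → suc (2 * (n * s + q)) ≤ c → T + D < T + r + c
  T+D<dn {T} {s} {r} {q} {c} D≡ ≤c = by-slack (n * s + 2 * q)
    (≤-reflexive (sym D≡) ∧≤ ≤c ∧≤ scale s)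
    (solve (n ∷ D ∷ T ∷ s ∷ r ∷ q ∷ c ∷ []))

  dn<v : ∀ {s r q c} → s + r ≡ D → 1 ≤ r → q < n → c ≤ suc (2 * (n * s + q)) + n →
         2 * (n * (D + M)) + 2 * n + γ + 2 * e + r + c < suc (n * (suc (suc (M + D) * 2) * 2))
  dn<v {s} {r} {q} {c} D≡ 1≤r q<n c≤ = by-slack (1 + 2 * (n * M))
    (c≤ ∧≤ nD≤ ∧≤ nD≤ ∧≤ q<n ∧≤ q<n ∧≤ e<n ∧≤ e<n ∧≤ γ≤2 ∧≤ scale r ∧≤ n≤nr)
    (solve (n ∷ M ∷ D ∷ γ ∷ e ∷ s ∷ r ∷ q ∷ c ∷ []))
    where
    nD≤ : n * (s + r) ≤ n * D
    nD≤ = ≤-reflexive (cong (n *_) D≡)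
    n≤nr : n ≤ n * r
    n≤nr = subst (_≤ n * r) (*-identityʳ n) (*-monoʳ-≤ n 1≤r)

-- The splitting of the differences into pairs and triples.

-- The pairs are {low t , low t + 1}; the differences 2a + 1, …, 2a + n skipped by low are the u's.
module Differences (n a : ℕ) where

  shift low : ℕ → ℕ
  shift t with a ≤? t
  ... | yes _ = n
  ... | no  _ = 0
  low t = suc (2 * t) + shift t

  shift-small : ∀ {t} → t < a → shift t ≡ 0
  shift-small {t} t<a with a ≤? t
  ... | yes a≤t = contradiction t<a (≤⇒≯ a≤t)
  ... | no  _   = refl

  shift-big : ∀ {t} → a ≤ t → shift t ≡ n
  shift-big {t} a≤t with a ≤? t
  ... | yes _   = refl
  ... | no  a≰t = contradiction a≤t a≰t

  low-small : ∀ {t} → t < a → low t ≡ suc (t * 2)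
  low-small {t} t<a = trans (cong (suc (2 * t) +_) (shift-small t<a)) (solve (t ∷ []))

  low-big : ∀ {t} → a ≤ t → low t ≡ suc (2 * t) + n
  low-big {t} a≤t = cong (suc (2 * t) +_) (shift-big a≤t)

  low≥ : ∀ t → suc (2 * t) ≤ low t
  low≥ t = m≤m+n (suc (2 * t)) (shift t)

  low≤ : ∀ t → low t ≤ suc (2 * t) + n
  low≤ t = +-monoʳ-≤ (suc (2 * t)) shift≤
    where
    shift≤ : shift t ≤ n
    shift≤ with a ≤? t
    ... | yes _ = ≤-refl
    ... | no  _ = z≤n

  -- Each index adds 2 and `shift` never decreases. The factor 2 outweighs the unit steps of the hub
  -- in `up-dec` and `dn-inc`.
  low-mono : ∀ {s t} δ → s + δ ≤ t → low s + 2 * δ ≤ low t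
  low-mono {s} {t} δ s+δ≤t = aux (shift s) (shift t) shift≤
    where
    aux : ∀ x y → x ≤ y → suc (2 * s) + x + 2 * δ ≤ suc (2 * t) + y
    aux x y x≤y = by-slack 0 (s+δ≤t ∧≤ s+δ≤t ∧≤ x≤y) (solve (s ∷ t ∷ δ ∷ x ∷ y ∷ []))
    shift≤ : shift s ≤ shift t
    shift≤ with a ≤? s | a ≤? t
    ... | no  _   | _       = z≤n
    ... | yes _   | yes _   = ≤-refl
    ... | yes a≤s | no  a≰t = contradiction (≤-trans a≤s (≤-trans (m≤m+n s δ) s+δ≤t)) a≰t

  low-increasing : ∀ {s t} → s < t → low s < low t
  low-increasing {s} {t} s<t = ≤-trans (subst (suc (low s) ≤_) (+-comm 2 (low s)) (n≤1+n _))
    (low-mono 1 (subst (_≤ t) (+-comm 1 s) s<t))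

  low-injective : ∀ {s t} → low s ≡ low t → s ≡ t
  low-injective {s} {t} eq with <-cmp s t
  ... | tri< s<t _ _ = contradiction eq (<⇒≢ (low-increasing s<t))
  ... | tri≈ _ s≡t _ = s≡t
  ... | tri> _ _ t<s = contradiction (sym eq) (<⇒≢ (low-increasing t<s))

  module Cover {Q γ} (a≤Q : a ≤ Q) (γ≡ : γ ≡ 1 ⊎ γ ≡ 2) where

    -- The roles of a difference: member of a pair, u, w, T, or the complement of T with respect to
    -- `suc (4 * Q + 6 * n)`, which is v once `Q` is `n * p`.
    data Covered : ℕ → Set where
      lower    : ∀ {t} → t < Q → Covered (low t)
      upper    : ∀ {t} → t < Q → Covered (suc (low t))
      inner    : ∀ {e} → e < n → Covered (suc (2 * a + e))
      outer    : ∀ {e} → e < n → Covered (suc (2 * Q + n + e))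
      closing  : ∀ {e} → e < n → Covered (2 * Q + 2 * n + γ + 2 * e)
      closing⁻ : ∀ {e d} → e < n → d + (2 * Q + 2 * n + γ + 2 * e) ≡ suc (4 * Q + 6 * n) → Covered d

    -- The range is cut at 2a, 2a + n, 2Q + n and 2Q + 2n. The segments hold pairs, the u's, further
    -- pairs, the w's, and finally the T's up to sign. In the segments of pairs the parity of the
    -- offset tells lower members from upper ones.
    covered : ∀ {d} → 1 ≤ d → d ≤ 2 * Q + 3 * n → Covered d
    covered {d} 1≤d d≤ with d ≤? 2 * a
    covered {suc d} _ d≤ | yes d≤2a with parity d
    ... | even t = subst Covered (low-small t<a) (lower (<-≤-trans t<a a≤Q))
      where
      t<a : t < a
      t<a = *-cancelʳ-< 2 t a (by-slack 0 d≤2a (solve (t ∷ a ∷ [])))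
    ... | odd t = subst Covered (cong suc (low-small t<a)) (upper (<-≤-trans t<a a≤Q))
      where
      t<a : t < a
      t<a = *-cancelʳ-< 2 t a (by-slack 1 d≤2a (solve (t ∷ a ∷ [])))
    covered {d} _ d≤ | no d≰2a with d ≤? 2 * a + n
    ... | yes d≤2a+n = subst Covered d≡ 
      (inner (+-cancelˡ-< (2 * a) o n (subst (_≤ 2 * a + n) (sym d≡) d≤2a+n)))
      where
      o = d ∸ suc (2 * a)
      d≡ : suc (2 * a + o) ≡ d
      d≡ = m+[n∸m]≡n (≰⇒> d≰2a)
    ... | no d≰2a+n with d ≤? 2 * Q + n
    ...   | yes d≤2Q+n = aux o (parity o) d≡
      where
      o = d ∸ suc (2 * a + n)
      d≡ : suc (2 * a + n) + o ≡ d
      d≡ = m+[n∸m]≡n (≰⇒> d≰2a+n)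
      aux : ∀ o → Parity o → suc (2 * a + n) + o ≡ d → Covered d
      aux _ (even j) refl = subst Covered
        (trans (low-big (m≤m+n a j)) (solve (a ∷ j ∷ n ∷ [])))
        (lower (*-cancelʳ-< 2 (a + j) Q (by-slack 0 d≤2Q+n (solve (a ∷ j ∷ n ∷ Q ∷ [])))))
      aux _ (odd j) refl = subst Covered
        (trans (cong suc (low-big (m≤m+n a j))) (solve (a ∷ j ∷ n ∷ [])))
        (upper (*-cancelʳ-< 2 (a + j) Q (by-slack 1 d≤2Q+n (solve (a ∷ j ∷ n ∷ Q ∷ [])))))
    ...   | no d≰2Q+n with d ≤? 2 * Q + n + n
    ...     | yes d≤2Q+2n = subst Covered d≡
      (outer (+-cancelˡ-< (2 * Q + n) o n (subst (_≤ 2 * Q + n + n) (sym d≡) d≤2Q+2n)))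
      where
      o = d ∸ suc (2 * Q + n)
      d≡ : suc (2 * Q + n + o) ≡ d
      d≡ = m+[n∸m]≡n (≰⇒> d≰2Q+n)
    ...     | no d≰2Q+2n = fold γ≡ o (parity o) d≡
      where
      o = d ∸ suc (2 * Q + n + n)
      d≡ : suc (2 * Q + n + n) + o ≡ d
      d≡ = m+[n∸m]≡n (≰⇒> d≰2Q+2n)

      o<n : ∀ {o} → suc (2 * Q + n + n) + o ≡ d → o < n
      o<n {o} refl = by-slack 0 d≤ (solve (o ∷ n ∷ Q ∷ []))

      j<n : ∀ {j} → suc (2 * Q + n + n) + j * 2 ≡ d → j < n
      j<n {j} eq = ≤-<-trans (m≤m*n j 2) (o<n eq)

      j<n′ : ∀ {j} → suc (2 * Q + n + n) + suc (j * 2) ≡ d → j < n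
      j<n′ {j} eq = ≤-<-trans (≤-trans (m≤m*n j 2) (n≤1+n _)) (o<n eq)

      complement<n : ∀ {j e} → suc j + e ≡ n → e < n
      complement<n {j} {e} eq = subst (suc e ≤_) eq (s≤s (m≤n+m e j))

      -- All T's have the parity of `γ`. In that parity the difference at half-offset `j` is the T
      -- of block j; in the other it is the complement of the T of block n - 1 - j.
      fold : γ ≡ 1 ⊎ γ ≡ 2 → ∀ o → Parity o → suc (2 * Q + n + n) + o ≡ d → Covered d

      fold (inj₁ refl) _ (even j) eq = subst Covered (trans value eq) (closing {j} (j<n {j} eq))
        where
        value : 2 * Q + 2 * n + 1 + 2 * j ≡ suc (2 * Q + n + n) + j * 2
        value = solve (Q ∷ n ∷ j ∷ [])
      fold (inj₂ refl) _ (odd j)  eq = subst Covered (trans value eq) (closing {j} (j<n′ {j} eq))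
        where
        value : 2 * Q + 2 * n + 2 + 2 * j ≡ suc (2 * Q + n + n) + suc (j * 2)
        value = solve (Q ∷ n ∷ j ∷ [])
      fold (inj₂ refl) _ (even j) eq = closing⁻ (complement<n {j} (m+[n∸m]≡n (j<n eq)))
        (trans (cong (_+ _) (sym eq)) (reflect (n ∸ suc j) (m+[n∸m]≡n (j<n eq))))
        where
        reflect : ∀ e → suc j + e ≡ n →
          suc (2 * Q + n + n) + j * 2 + (2 * Q + 2 * n + 2 + 2 * e) ≡ suc (4 * Q + 6 * n)
        reflect e refl = solve (Q ∷ j ∷ e ∷ [])
      fold (inj₁ refl) _ (odd j)  eq = closing⁻ (complement<n {j} (m+[n∸m]≡n (j<n′ eq)))
        (trans (cong (_+ _) (sym eq)) (reflect (n ∸ suc j) (m+[n∸m]≡n (j<n′ eq))))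
        where
        reflect : ∀ e → suc j + e ≡ n →
          suc (2 * Q + n + n) + suc (j * 2) + (2 * Q + 2 * n + 1 + 2 * e) ≡ suc (4 * Q + 6 * n)
        reflect e refl = solve (Q ∷ j ∷ e ∷ [])

-- Reduction of natural numbers modulo v.

mod-+ : ∀ {w} a b → (a + b) mod suc w ≡ (a mod suc w) ⊕ (b mod suc w)
mod-+ {w} a b = Fin.toℕ-injective $ begin
  toℕ ((a + b) mod suc w)                             ≡⟨ toℕ-mod (a + b) ⟩
  (a + b) % suc w                                     ≡⟨ %-distribˡ-+ a b (suc w) ⟩
  (a % suc w + b % suc w) % suc w                     ≡⟨ cong₂ (λ x y → (x + y) % suc w) (toℕ-mod a) (toℕ-mod b) ⟨
  (toℕ (a mod suc w) + toℕ (b mod suc w)) % suc w     ≡⟨ toℕ-⊕ (a mod suc w) (b mod suc w) ⟨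
  toℕ ((a mod suc w) ⊕ (b mod suc w))                 ∎
  where open ≡-Reasoning

mod-zero : ∀ {w} → suc w mod suc w ≡ zero
mod-zero {w} = Fin.toℕ-injective (trans (toℕ-mod (suc w)) (n%n≡0 (suc w)))

mod-injective : ∀ {w a b} → a < suc w → b < suc w → a mod suc w ≡ b mod suc w → a ≡ b
mod-injective {w} {a} {b} a< b< eq = begin
  a                   ≡⟨ m<n⇒m%n≡m a< ⟨
  a % suc w           ≡⟨ toℕ-mod a ⟨
  toℕ (a mod suc w)   ≡⟨ cong toℕ eq ⟩
  toℕ (b mod suc w)   ≡⟨ toℕ-mod b ⟩
  b % suc w           ≡⟨ m<n⇒m%n≡m b< ⟩
  b                   ∎
  where open ≡-Reasoning

mod-toℕ-id : ∀ {w} (x : Fin (suc w)) → toℕ x mod suc w ≡ x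
mod-toℕ-id x = Fin.toℕ-injective (trans (toℕ-mod (toℕ x)) (mod-toℕ x))

edge-sym : ∀ {v k} {B : Vec (Fin v) k} {x y} → Edge B x y → Edge B y x
edge-sym (i , e) = i , Sum.swap e

-- The base cycles.

-- Here p = M + D with M pairs used on the way up and D = M + ε on the way down.  The equation
-- balance says u + w = T + ε, and γ is chosen to make the number of differences below the u's an
-- even number 2a.  The T's have equal parity and lie between nk − n and nk + n; since v is odd,
-- they are the n largest differences modulo v and up to sign.
module Family (n M ε γ a : ℕ) (1≤n : 1 ≤ n) (1≤M : 1 ≤ M) (ε≤1 : ε ≤ 1)
  (γ≡ : γ ≡ 1 ⊎ γ ≡ 2) (balance : 2 * a + 2 ≡ n + γ + ε) where

  D H k w v p : ℕ
  D = M + ε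
  H = suc (M + D)
  k = suc (H * 2)
  w = n * (k * 2)
  v = suc w
  p = D + M

  Shuffles : Set
  Shuffles = ℕ → Permutation′ n

  open Differences n a

  T : Fin n → ℕ
  T e = 2 * (n * p) + 2 * n + γ + 2 * toℕ e

  private
    1≤D : 1 ≤ D
    1≤D = ≤-trans 1≤M (m≤m+n M ε)

    1≤γ : 1 ≤ γ
    1≤γ = [ (λ { refl → s≤s z≤n }) , (λ { refl → s≤s z≤n }) ]′ γ≡

    γ≤2 : γ ≤ 2
    γ≤2 = [ (λ { refl → s≤s z≤n }) , (λ { refl → s≤s (s≤s z≤n) }) ]′ γ≡

    a≤n : a ≤ n
    a≤n = *-cancelˡ-≤ 2 (by-slack 0 (≤-reflexive balance ∧≤ γ≤2 ∧≤ ε≤1 ∧≤ 1≤n)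
      (solve (a ∷ n ∷ γ ∷ ε ∷ [])))

    n≤n*m : ∀ {m} → 1 ≤ m → n ≤ n * m
    n≤n*m {m} 1≤m = subst (_≤ n * m) (*-identityʳ n) (*-monoʳ-≤ n 1≤m)

  mirror : ℕ → ℕ
  mirror r = M ∸ suc r

  mirror<M : ∀ {r} → r < M → mirror r < M
  mirror<M {r} r<M = subst (suc (mirror r) ≤_) (m+[n∸m]≡n r<M) (s≤s (m≤n+m (mirror r) r))

  mirror-involutive : ∀ {r} → r < M → mirror (mirror r) ≡ r
  mirror-involutive {r} r<M = trans
    (cong (_∸ suc (mirror r)) (trans (sym (m+[n∸m]≡n r<M)) (sym (+-suc r (mirror r)))))
    (m+n∸n≡m r (suc (mirror r)))

  module Block (π : Shuffles) (e : Fin n) where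

    -- `slot b` is the number of the pair that block `e` receives from band `b`. Bands below `D`
    -- serve the descent in increasing order; the remaining `M` serve the climb from the largest
    -- down, since `up` must decrease.
    slot up dn : ℕ → ℕ
    slot b = n * b + toℕ (π b ⟨$⟩ʳ e)
    up j   = j + suc (low (slot (D + mirror j)))
    dn s   = T e + (D ∸ s) + low (slot s)

    up-mirror : ∀ {r} → r < M → up (mirror r) ≡ mirror r + suc (low (slot (D + r)))
    up-mirror {r} r<M = cong (λ r′ → mirror r + suc (low (slot (D + r′)))) (mirror-involutive r<M)

    -- The vertex halfway through the jump, M + u, where u = 2a + 1 + e is one of the differences
    -- skipped by `low`.
    μ : ℕ
    μ = M + suc (2 * a + toℕ e)

    open Zigzag M D μ (T e) up dn public hiding (H; module Distinct)

    private
      open Inequalities {n} {M} {D} {γ} {ε} {a} {toℕ e}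
        1≤n (Fin.toℕ<n e) 1≤D ε≤1 1≤γ γ≤2 balance

      -- A place in a band is less than n, so climbing δ + 1 bands gains at least nδ + 1 whatever
      -- the permutations are.
      slot-mono : ∀ {s t} δ → t ≡ s + suc δ → slot s + suc δ ≤ slot t
      slot-mono {s} δ refl = aux (toℕ (π s ⟨$⟩ʳ e)) (toℕ (π (s + suc δ) ⟨$⟩ʳ e)) (Fin.toℕ<n (π s ⟨$⟩ʳ e))
        where
        aux : ∀ q q′ → q < n → n * s + q + suc δ ≤ n * (s + suc δ) + q′
        aux q q′ q<n = by-slack q′ (q<n ∧≤ subst (_≤ n * δ) (*-identityˡ δ) (*-monoˡ-≤ δ 1≤n))
          (solve (n ∷ s ∷ δ ∷ q ∷ q′ ∷ []))

      -- As D ≥ 1, band D + r begins at pair number n or later, and a ≤ n: the climb only uses pairs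
      -- above the u's.
      low-slot-big : ∀ r → low (slot (D + r)) ≡ suc (2 * slot (D + r)) + n
      low-slot-big r = low-big (≤-trans a≤n (≤-trans (n≤n*m (≤-trans 1≤D (m≤m+n D r))) (m≤m+n _ _)))

      up-big : ∀ j → up j ≡ j + suc (suc (2 * slot (D + (M ∸ suc j))) + n)
      up-big j = cong (λ c → j + suc c) (low-slot-big (M ∸ suc j))

      up-dec : ∀ {i j} → i < j → j < M → up j < up i
      up-dec {i} {j} i<j j<M = aux (low (slot (D + (M ∸ suc j)))) (low (slot (D + (M ∸ suc i))))
        (low-mono (suc δ) (slot-mono δ (trans (cong (D +_) r≡) (sym (+-assoc D _ (suc δ))))))
        where
        δ = j ∸ suc i
        j≡ : i + suc δ ≡ j
        j≡ = trans (+-suc i δ) (m+[n∸m]≡n i<j)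
        r≡ : M ∸ suc i ≡ (M ∸ suc j) + suc δ
        r≡ = +-cancelˡ-≡ (suc i) _ _ (begin
          suc i + (M ∸ suc i)               ≡⟨ m+[n∸m]≡n (<-trans i<j j<M) ⟩
          M                                 ≡⟨ m+[n∸m]≡n j<M ⟨
          suc j + (M ∸ suc j)               ≡⟨ cong (λ i → suc i + (M ∸ suc j)) (sym j≡) ⟩
          suc (i + suc δ) + (M ∸ suc j)     ≡⟨ rearrange (M ∸ suc j) δ ⟩
          suc i + ((M ∸ suc j) + suc δ)     ∎)
          where
          open ≡-Reasoning
          rearrange : ∀ r δ → suc (i + suc δ) + r ≡ suc i + (r + suc δ)
          rearrange r δ = solve (i ∷ r ∷ δ ∷ [])
        aux : ∀ lⱼ lᵢ → lⱼ + 2 * suc δ ≤ lᵢ → j + suc lⱼ < i + suc lᵢ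
        aux lⱼ lᵢ l≤ = aux′ δ (≤-reflexive (sym j≡)) l≤
          where
          aux′ : ∀ δ → j ≤ i + suc δ → lⱼ + 2 * suc δ ≤ lᵢ → j + suc lⱼ < i + suc lᵢ
          aux′ δ j≤ l≤ = by-slack δ (j≤ ∧≤ l≤) (solve (i ∷ j ∷ δ ∷ lⱼ ∷ lᵢ ∷ []))

      dn-inc : ∀ {s t} → s < t → t < D → dn s < dn t
      dn-inc {s} {t} s<t t<D = aux (T e) (t ∸ suc s) (low (slot s)) (low (slot t)) (D ∸ s) (D ∸ t)
        (low-mono (suc δ) (slot-mono δ (sym t≡)))
        (≤-reflexive (+-cancelˡ-≡ s _ _ (begin
          s + (D ∸ s)                 ≡⟨ m+[n∸m]≡n (<⇒≤ (<-trans s<t t<D)) ⟩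
          D                           ≡⟨ m+[n∸m]≡n (<⇒≤ t<D) ⟨
          t + (D ∸ t)                 ≡⟨ cong (_+ (D ∸ t)) (sym t≡) ⟩
          s + suc δ + (D ∸ t)         ≡⟨ +-assoc s (suc δ) (D ∸ t) ⟩
          s + (suc δ + (D ∸ t))       ≡⟨ cong (s +_) (+-comm (suc δ) (D ∸ t)) ⟩
          s + ((D ∸ t) + suc δ)       ∎)))
        where
        open ≡-Reasoning
        δ = t ∸ suc s
        t≡ : s + suc δ ≡ t
        t≡ = trans (+-suc s δ) (m+[n∸m]≡n s<t)
        aux : ∀ T δ lₛ lₜ rₛ rₜ → lₛ + 2 * suc δ ≤ lₜ → rₛ ≤ rₜ + suc δ → T + rₛ + lₛ < T + rₜ + lₜ
        aux T δ lₛ lₜ rₛ rₜ l≤ r≤ = by-slack δ (l≤ ∧≤ r≤) (solve (T ∷ δ ∷ lₛ ∷ lₜ ∷ rₛ ∷ rₜ ∷ []))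

      s+[D∸s] : ∀ {s} → s < D → s + (D ∸ s) ≡ D
      s+[D∸s] s<D = m+[n∸m]≡n (<⇒≤ s<D)

    open Zigzag.Distinct M D μ (T e) up dn {v} (m<m+n M (s≤s z≤n)) μ<T
      (λ {j} j<M → subst (μ <_) (sym (up-big j)) (μ<up (m+[n∸m]≡n j<M)))
      (λ {j} j<M → subst (_< T e) (sym (up-big j))
        (up<T (m+[n∸m]≡n j<M) (Fin.toℕ<n (π (D + (M ∸ suc j)) ⟨$⟩ʳ e))))
      T+D<v
      (λ {s} s<D → T+D<dn {T e} (s+[D∸s] s<D) (low≥ (slot s)))
      (λ {s} s<D → dn<v (s+[D∸s] s<D) (m<n⇒0<n∸m s<D) (Fin.toℕ<n (π s ⟨$⟩ʳ e)) (low≤ (slot s)))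
      up-dec dn-inc public using (vertex-injective; vertex<v)

  base : Shuffles → Fin n → Vec (Fin v) k
  base π e = tabulate λ i → Block.vertex π e (toℕ i) mod v

  at : ℕ → Fin k
  at m = m mod k

  toℕ-at : ∀ {m} → m < k → toℕ (at m) ≡ m
  toℕ-at {m} m<k = trans (toℕ-mod m) (m<n⇒m%n≡m m<k)

  next-at : ∀ {m} → m < k → next (at m) ≡ at (suc m)
  next-at m<k = cong (λ m → suc m mod k) (toℕ-at m<k)

  at-last : at (H * 2) ≡ fromℕ (H * 2)
  at-last = Fin.toℕ-injective (trans (toℕ-at ≤-refl) (sym (Fin.toℕ-fromℕ (H * 2))))

  even<k : ∀ {j} → j ≤ H → j * 2 < k
  even<k j≤H = s≤s (*-monoˡ-≤ 2 j≤H)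

  odd<k : ∀ {j} → j < H → suc (j * 2) < k
  odd<k j<H = <-trans ≤-refl (even<k j<H)

  -- Every nonzero residue is a difference of some base cycle.

  module Cycles (π : Shuffles) where

    module _ (e : Fin n) where
      open Block π e

      base-unique : Unique (base π e)
      base-unique = Unique.tabulate⁺ λ {i} {j} eq → Fin.toℕ-injective
        (vertex-injective (Fin.toℕ<n i) (Fin.toℕ<n j)
          (mod-injective (vertex<v (Fin.toℕ<n i)) (vertex<v (Fin.toℕ<n j)) eq))

      lookup-at : ∀ {m} → m < k → lookup (base π e) (at m) ≡ vertex m mod v
      lookup-at {m} m<k = trans (Vec.lookup∘tabulate (λ i → vertex (toℕ i) mod v) (at m))
        (cong (λ i → vertex i mod v) (toℕ-at m<k))

      lookup-hub : ∀ {j} → j ≤ H → lookup (base π e) (at (j * 2)) ≡ hub j mod v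
      lookup-hub {j} j≤H = trans (lookup-at (even<k j≤H)) (cong (_mod v) (interleave-even hub rim j))

      lookup-rim : ∀ {j} → j < H → lookup (base π e) (at (suc (j * 2))) ≡ rim j mod v
      lookup-rim {j} j<H = trans (lookup-at (odd<k j<H)) (cong (_mod v) (interleave-odd hub rim j))

      edge-at : ∀ {m} → m < k → Edge (base π e) (lookup (base π e) (at m)) (lookup (base π e) (at (suc m)))
      edge-at {m} m<k = at m , inj₁ (refl , cong (lookup (base π e)) (sym (next-at m<k)))

      hub–rim : ∀ {j} → j < H → Edge (base π e) (hub j mod v) (rim j mod v)
      hub–rim j<H = subst₂ (Edge (base π e)) (lookup-hub (<⇒≤ j<H)) (lookup-rim j<H)
        (edge-at (even<k (<⇒≤ j<H)))

      rim–hub : ∀ {j} → j < H → Edge (base π e) (rim j mod v) (hub (suc j) mod v)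
      rim–hub j<H = subst₂ (Edge (base π e)) (lookup-rim j<H) (lookup-hub j<H) (edge-at (odd<k j<H))

      lookup-last : lookup (base π e) (fromℕ (H * 2)) ≡ T e mod v
      lookup-last = trans (cong (lookup (base π e)) (sym at-last))
        (trans (lookup-hub ≤-refl) (cong (_mod v) hub-last))

      lookup-zero : lookup (base π e) zero ≡ zero
      lookup-zero = mod-toℕ-id zero

      closing-edge : Edge (base π e) (T e mod v) zero
      closing-edge = fromℕ (H * 2) , inj₁ (sym lookup-last ,
        sym (trans (cong (lookup (base π e)) next-last) lookup-zero))

      residue-edge : ∀ {α α′ β β′} → α ≡ α′ → β ≡ β′ →
        Edge (base π e) (α mod v) (β mod v) → Edge (base π e) (α′ mod v) (β′ mod v)
      residue-edge refl refl E = E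

      span : ∀ α {β} d → α + d ≡ β → Edge (base π e) (α mod v) (β mod v) →
             Edge (base π e) (α mod v) ((α mod v) ⊕ (d mod v))
      span α d refl = subst (Edge (base π e) (α mod v)) (mod-+ α d)

    Spans : Fin v → Set
    Spans δ = ∃[ e ] ∃[ x ] Edge (base π e) x (x ⊕ δ)

    -- The same edge read from its other end.
    Spans-neg : ∀ {δ δ′} → δ ⊕ δ′ ≡ zero → Spans δ → Spans δ′
    Spans-neg {δ} {δ′} δ⊕δ′ (e , x , E) = e , x ⊕ δ ,
      edge-sym {B = base π e} (subst (λ y → Edge (base π e) y (x ⊕ δ)) (sym undo) E)
      where
      undo : (x ⊕ δ) ⊕ δ′ ≡ x
      undo = trans (⊕-assoc x δ δ′) (trans (cong (x ⊕_) δ⊕δ′) (⊕-identityʳ x))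

    -- In band b the pair number n b + q is used by the block that π b sends to q.
    slot-onto : ∀ {t} → t < n * p → ∃[ b ] ∃[ e ] b < p × Block.slot π e b ≡ t
    slot-onto {t} t< = b , e , *-cancelˡ-< n b p (≤-<-trans (m≤m+n (n * b) q) (subst (_< n * p) (sym t≡) t<))
      , trans (cong (λ q → n * b + toℕ q) (Perm.inverseʳ (π b)))
          (trans (cong (n * b +_) (Fin.toℕ-fromℕ< _)) t≡)
      where
      instance
        n≢0 : NonZero n
        n≢0 = >-nonZero 1≤n
      b = t div n
      q = t % n
      e = π b ⟨$⟩ˡ (t mod n)
      t≡ : n * b + q ≡ t
      t≡ = trans (+-comm (n * b) q) (trans (cong (q +_) (*-comm n b)) (sym (m≡m%n+[m/n]*n t n)))

    -- A climbing or descending rim vertex stands between two hubs that are consecutive integers, so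
    -- its two edges have consecutive differences.
    spans-pair : ∀ {t} → t < n * p → Spans (low t mod v) × Spans (suc (low t) mod v)
    spans-pair t< with slot-onto t<
    ... | b , e , b<p , refl with split D b
    ...   | before b<D =
        (e , _ , span e (T e + (D ∸ b)) (low (slot b)) refl (residue-edge e
          (hub-high b) (rim-dn b) (hub–rim e j<H)))
      , (e , _ , span e (T e + (D ∸ suc b)) (suc (low (slot b))) dn≡
          (edge-sym {B = base π e} (residue-edge e
          (rim-dn b) (trans (cong hub (cong suc (sym (+-suc M b)))) (hub-high (suc b))) (rim–hub e j<H))))
      where
      open Block π e
      j<H : suc M + b < H
      j<H = +-monoʳ-< (suc M) b<D
      dn≡ : T e + (D ∸ suc b) + suc (low (slot b)) ≡ dn b
      dn≡ = trans (+-suc (T e + (D ∸ suc b)) (low (slot b))) (cong (_+ low (slot b))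
        (trans (sym (+-suc (T e) (D ∸ suc b))) (cong (T e +_) (sym (+-∸-assoc 1 b<D)))))
    ...   | after r =
        (e , _ , span e (suc j) (low (slot (D + r))) (sym (trans up≡ (+-suc j _)))
          (edge-sym {B = base π e} (residue-edge e
          (rim-up j<M) (hub-low j<M) (rim–hub e j<H))))
      , (e , _ , span e j (suc (low (slot (D + r)))) (sym up≡) (residue-edge e
          (hub-low (<⇒≤ j<M)) (rim-up j<M) (hub–rim e j<H)))
      where
      open Block π e
      r<M : r < M
      r<M = +-cancelˡ-< D r M b<p
      j = mirror r
      j<M : j < M
      j<M = mirror<M r<M
      j<H : j < H
      j<H = ≤-trans j<M (≤-trans (m≤m+n M D) (n≤1+n _))
      up≡ : up j ≡ j + suc (low (slot (D + r)))
      up≡ = up-mirror r<M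

    n*k≡ : n * k ≡ 2 * (n * p) + 3 * n
    n*k≡ = pure n M D
      where
      pure : ∀ n M D → n * suc (suc (M + D) * 2) ≡ 2 * (n * (D + M)) + 3 * n
      pure n M D = solve (n ∷ M ∷ D ∷ [])

    v≡ : suc (4 * (n * p) + 6 * n) ≡ v
    v≡ = cong suc (pure n M D)
      where
      pure : ∀ n M D → 4 * (n * (D + M)) + 6 * n ≡ n * (suc (suc (M + D) * 2) * 2)
      pure n M D = solve (n ∷ M ∷ D ∷ [])

    -- The relation u + w = T + ε with M added to both sides, as D = M + ε. It makes w = 2np + n + 1
    -- + e the difference from `μ` to the top hub T + D.
    core : ∀ e → Block.μ π e + suc (2 * (n * p) + n + toℕ e) ≡ T e + D
    core e = pure (n * p) (toℕ e) balance
      where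
      pure : ∀ Q e → 2 * a + 2 ≡ n + γ + ε →
        M + suc (2 * a + e) + suc (2 * Q + n + e) ≡ 2 * Q + 2 * n + γ + 2 * e + (M + ε)
      pure Q e bal = begin
        M + suc (2 * a + e) + suc (2 * Q + n + e)    ≡⟨ solve (M ∷ a ∷ e ∷ Q ∷ n ∷ []) ⟩
        M + 2 * Q + n + 2 * e + (2 * a + 2)          ≡⟨ cong (M + 2 * Q + n + 2 * e +_) bal ⟩
        M + 2 * Q + n + 2 * e + (n + γ + ε)          ≡⟨ solve (M ∷ Q ∷ e ∷ n ∷ γ ∷ ε ∷ []) ⟩
        2 * Q + 2 * n + γ + 2 * e + (M + ε)          ∎
        where open ≡-Reasoning

    open Cover {n * p} {γ} (≤-trans a≤n (n≤n*m (≤-trans 1≤D (m≤m+n D M)))) γ≡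

    covered⇒spans : ∀ {d} → Covered d → Spans (d mod v)
    covered⇒spans (lower t<) = proj₁ (spans-pair t<)
    covered⇒spans (upper t<) = proj₂ (spans-pair t<)
    covered⇒spans (inner {e} e<n) = e′ , _ , span e′ M (suc (2 * a + e))
      (cong (λ e → M + suc (2 * a + e)) (sym (Fin.toℕ-fromℕ< e<n)))
      (residue-edge e′ (hub-low ≤-refl) rim-mid (hub–rim e′ (s≤s (m≤m+n M D))))
      where
      e′ = fromℕ< e<n
      open Block π e′
    covered⇒spans (outer {e} e<n) = e′ , _ , span e′ μ (suc (2 * (n * p) + n + e))
      (trans (cong (λ e → μ + suc (2 * (n * p) + n + e)) (sym (Fin.toℕ-fromℕ< e<n))) (core e′))
      (residue-edge e′ rim-mid
        (trans (cong hub (cong suc (sym (+-identityʳ M)))) (hub-high 0)) (rim–hub e′ (s≤s (m≤m+n M D))))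
      where
      e′ = fromℕ< e<n
      open Block π e′
    covered⇒spans (closing {e} e<n) = e′ , _ , span e′ 0 (2 * (n * p) + 2 * n + γ + 2 * e)
      (cong (λ e → 2 * (n * p) + 2 * n + γ + 2 * e) (sym (Fin.toℕ-fromℕ< e<n)))
      (edge-sym {B = base π e′}
        (subst (Edge (base π e′) (T e′ mod v)) (sym (mod-toℕ-id zero)) (closing-edge e′)))
      where
      e′ = fromℕ< e<n
    covered⇒spans (closing⁻ {e} {d} e<n d+T≡) = e′ , _ , span e′ (T e′) d
      (trans (cong (λ e → 2 * (n * p) + 2 * n + γ + 2 * e + d) (Fin.toℕ-fromℕ< e<n))
        (trans (+-comm _ d) (trans d+T≡ v≡)))
      (subst (Edge (base π e′) (T e′ mod v)) (sym mod-zero) (closing-edge e′))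
      where
      e′ = fromℕ< e<n

    -- Since v = 2nk + 1, either δ or -δ has a representative at most nk.
    spans : ∀ δ → δ ≢ zero → Spans δ
    spans δ δ≢0 with toℕ δ ≤? n * k
    ... | yes d≤nk = subst Spans (mod-toℕ-id δ) (covered⇒spans
      (covered (n≢0⇒n>0 (δ≢0 ∘ Fin.toℕ-injective)) (subst (toℕ δ ≤_) n*k≡ d≤nk)))
    ... | no  d≰nk = Spans-neg {d′ mod v} {δ} (trans (cong ((d′ mod v) ⊕_) (sym (mod-toℕ-id δ)))
        (trans (sym (mod-+ d′ (toℕ δ))) (trans (cong (_mod v) (m∸n+n≡m (<⇒≤ (Fin.toℕ<n δ)))) mod-zero)))
      (covered⇒spans (covered (m<n⇒0<n∸m (Fin.toℕ<n δ)) (subst (d′ ≤_) n*k≡ d′≤)))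
      where
      d′ = v ∸ toℕ δ
      d′≤ : d′ ≤ n * k
      d′≤ = m≤n+o⇒m∸n≤o v (toℕ δ) (subst (_≤ toℕ δ + n * k) double
        (+-monoˡ-≤ (n * k) (≰⇒> d≰nk)))
        where
        double : suc (n * k) + n * k ≡ v
        double = cong suc (trans (solve-double (n * k)) (*-assoc n k 2))
          where
          solve-double : ∀ m → m + m ≡ m * 2
          solve-double m = solve (m ∷ [])

    -- An edge with difference y - x is translated until it starts at x.
    covers : ∀ x y → x ≢ y → ∃[ e ] ∃[ z ] Edge (translate z (base π e)) x y
    covers x y x≢y =
      let δ , x⊕δ = ⊕-difference x y
          e , x₀ , E = spans δ (λ δ≡0 → x≢y
            (trans (sym (⊕-identityʳ x)) (trans (cong (x ⊕_) (sym δ≡0)) x⊕δ)))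
          z , x₀⊕z = ⊕-difference x₀ x
      in e , z , subst₂ (Edge (translate z (base π e))) x₀⊕z
           (trans (⊕-assoc x₀ δ z) (trans (cong (x₀ ⊕_) (⊕-comm δ z))
             (trans (sym (⊕-assoc x₀ z δ)) (trans (cong (_⊕ δ) x₀⊕z) x⊕δ))))
           (map-edge (_⊕ z) (base π e) E)

    open DifferenceFamily {w} {n} {k} refl (base π) base-unique covers public

-- Isomorphisms between designs of the family.

module Rigidity (n M ε γ a : ℕ) (1≤n : 1 ≤ n) (1≤M : 1 ≤ M) (ε≤1 : ε ≤ 1)
  (γ≡ : γ ≡ 1 ⊎ γ ≡ 2) (balance : 2 * a + 2 ≡ n + γ + ε) where

  open Family n M ε γ a 1≤n 1≤M ε≤1 γ≡ balance
  open Differences n a using (low; low-injective)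

  T̂ : Fin n → Fin v
  T̂ e = T e mod v

  -- Position 2 is the hub after 0. As `1 ≤ M` it belongs to the climb, so it carries 1 under every
  -- shuffle.
  lookup-one : ∀ π e → lookup (base π e) (at 2) ≡ 1 mod v
  lookup-one π e = trans (Cycles.lookup-hub π e (s≤s z≤n)) (cong (_mod v) (Block.hub-low π e 1≤M))

  -- The index of the hub before the last, which carries T + 1; counted from `suc M` so that
  -- `hub-high` applies.
  penultimate : ℕ
  penultimate = suc M + pred D

  penultimate≡ : penultimate ≡ M + D
  penultimate≡ = trans (sym (+-suc M (pred D)))
    (cong (M +_) (suc-pred D {{>-nonZero (≤-trans 1≤M (m≤m+n M ε))}}))

  lookup-penultimate : ∀ π e → lookup (base π e) (at (penultimate * 2)) ≡ T̂ e ⊕ (1 mod v)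
  lookup-penultimate π e = begin
    lookup (base π e) (at (penultimate * 2))   ≡⟨ Cycles.lookup-hub π e penultimate≤H ⟩
    Block.hub π e penultimate mod v            ≡⟨ cong (_mod v) (Block.hub-high π e (pred D)) ⟩
    (T e + (D ∸ pred D)) mod v                 ≡⟨ cong (λ r → (T e + r) mod v) D∸ ⟩
    (T e + 1) mod v                            ≡⟨ mod-+ (T e) 1 ⟩
    T̂ e ⊕ (1 mod v)                            ∎
    where
    open ≡-Reasoning
    penultimate≤H : penultimate ≤ H
    penultimate≤H = subst (_≤ H) (sym penultimate≡) (n≤1+n _)
    D∸ : D ∸ pred D ≡ 1
    D∸ = trans (cong (_∸ pred D) (sym (suc-pred D {{>-nonZero (≤-trans 1≤M (m≤m+n M ε))}})))
      (m+n∸n≡m 1 (pred D))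

  module _ (π π′ : Shuffles) (τ : Permutation′ v)
    (τ⊆ : relabel τ (Cycles.develop π) ⊆ Cycles.develop π′) where

    Fixes : Fin v → Set
    Fixes x = τ ⟨$⟩ʳ x ≡ x

    -- The image under τ of the translate of base π e has the same closing edge as that of
    -- base π′ e, so it is the same cycle of the second design.
    base-to-base : ∀ e z → Fixes z → Fixes (T̂ e ⊕ z) →
      ∀ i → τ ⟨$⟩ʳ (lookup (base π e) i ⊕ z) ≡ lookup (base π′ e) i ⊕ z
    base-to-base e z τz τTz i = begin
      τ ⟨$⟩ʳ (lookup (base π e) i ⊕ z)    ≡⟨ lookup-B i ⟨
      lookup B i                          ≡⟨ cycle-rigid (s≤s (s≤s z≤n)) B! C! B≈C last≡ zero≡ i ⟩
      lookup C i                          ≡⟨ lookup-C i ⟩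
      lookup (base π′ e) i ⊕ z            ∎
      where
      open ≡-Reasoning
      last : Fin k
      last = fromℕ (H * 2)

      B C : Vec (Fin v) k
      B = Vec.map (τ ⟨$⟩ʳ_) (translate z (base π e))
      C = translate z (base π′ e)

      lookup-B : ∀ i → lookup B i ≡ τ ⟨$⟩ʳ (lookup (base π e) i ⊕ z)
      lookup-B i = trans (Vec.lookup-map i (τ ⟨$⟩ʳ_) (translate z (base π e)))
        (cong (τ ⟨$⟩ʳ_) (Vec.lookup-map i (_⊕ z) (base π e)))

      lookup-C : ∀ i → lookup C i ≡ lookup (base π′ e) i ⊕ z
      lookup-C i = Vec.lookup-map i (_⊕ z) (base π′ e)

      B! : Unique B
      B! = Unique.map⁺
        (λ eq → trans (sym (Perm.inverseˡ τ)) (trans (cong (τ ⟨$⟩ˡ_) eq) (Perm.inverseˡ τ)))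
        (Unique.map⁺ (⊕-cancelʳ z) (Cycles.base-unique π e))

      C! : Unique C
      C! = Unique.map⁺ (⊕-cancelʳ z) (Cycles.base-unique π′ e)

      zero⊕z : zero ⊕ z ≡ z
      zero⊕z = trans (⊕-comm zero z) (⊕-identityʳ z)

      closing-B : Edge B (T̂ e ⊕ z) z
      closing-B = subst₂ (Edge B) τTz (trans (cong (τ ⟨$⟩ʳ_) zero⊕z) τz)
        (map-edge (τ ⟨$⟩ʳ_) (translate z (base π e)) (map-edge (_⊕ z) (base π e) (Cycles.closing-edge π e)))

      closing-C : Edge C (T̂ e ⊕ z) z
      closing-C = subst (Edge C (T̂ e ⊕ z)) zero⊕z (map-edge (_⊕ z) (base π′ e) (Cycles.closing-edge π′ e))

      B≈C : B ≈ C
      B≈C =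
        let e′ , z′ , B≈ = Cycles.develop-∈ π′
              (τ⊆ (∈≡⇒∈ (∈≡-map⁺ (Vec.map (τ ⟨$⟩ʳ_)) (Cycles.∈≡-develop π e z))))
            e′≡e , z′≡z = Cycles.edge-unique π′ e′ z′ e z
              (Equivalence.to (sameEdges B≈ (T̂ e ⊕ z) z) closing-B) closing-C
        in subst (B ≈_) (cong₂ (λ z e → translate z (base π′ e)) z′≡z e′≡e) B≈

      last≡ : lookup B last ≡ lookup C last
      last≡ = trans (lookup-B last) (trans (cong (λ x → τ ⟨$⟩ʳ (x ⊕ z)) (Cycles.lookup-last π e))
        (trans τTz (sym (trans (lookup-C last) (cong (_⊕ z) (Cycles.lookup-last π′ e))))))

      zero≡ : lookup B zero ≡ lookup C zero
      zero≡ = trans (lookup-B zero) (trans (cong (λ x → τ ⟨$⟩ʳ (x ⊕ z)) (Cycles.lookup-zero π e))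
        (trans (trans (cong (τ ⟨$⟩ʳ_) zero⊕z) τz)
        (sym (trans (lookup-C zero) (trans (cong (_⊕ z) (Cycles.lookup-zero π′ e)) zero⊕z)))))

    fixed-position : ∀ e z i → lookup (base π e) i ≡ lookup (base π′ e) i →
      Fixes z → Fixes (T̂ e ⊕ z) → Fixes (lookup (base π′ e) i ⊕ z)
    fixed-position e z i same τz τTz =
      trans (cong (λ x → τ ⟨$⟩ʳ (x ⊕ z)) (sym same)) (base-to-base e z τz τTz i)

    -- Every base cycle runs 0, …, 1, …, T + 1, …, T, so an isomorphism fixing z and T + z
    -- also fixes 1 + z and T + 1 + z.
    fixes-all : ∀ e → Fixes zero → Fixes (T̂ e) → ∀ x → Fixes x
    fixes-all e τ0 τT x = subst Fixes (mod-toℕ-id x) (proj₁ (fixes-mod (toℕ x)))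
      where
      fixes-mod : ∀ m → Fixes (m mod v) × Fixes (T̂ e ⊕ (m mod v))
      fixes-mod zero = subst Fixes (sym (mod-toℕ-id zero)) τ0 ,
        subst Fixes (sym (trans (cong (T̂ e ⊕_) (mod-toℕ-id zero)) (⊕-identityʳ (T̂ e)))) τT
      fixes-mod (suc m) =
        let τz , τTz = fixes-mod m
            fix = λ i same → fixed-position e (m mod v) i same τz τTz
        in subst Fixes (trans (cong (_⊕ (m mod v)) (lookup-one π′ e)) (sym (mod-+ 1 m)))
             (fix (at 2) (trans (lookup-one π e) (sym (lookup-one π′ e))))
         , subst Fixes (trans (cong (_⊕ (m mod v)) (lookup-penultimate π′ e))
             (trans (⊕-assoc (T̂ e) (1 mod v) (m mod v)) (cong (T̂ e ⊕_) (sym (mod-+ 1 m)))))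
             (fix (at (penultimate * 2)) (trans (lookup-penultimate π e) (sym (lookup-penultimate π′ e))))

    -- By `fixes-all` the isomorphism is the identity, so `base-to-base` at z = 0 compares the base
    -- cycles themselves.
    same-base : ∀ e₀ → Fixes zero → Fixes (T̂ e₀) → ∀ e i → lookup (base π e) i ≡ lookup (base π′ e) i
    same-base e₀ τ0 τT e i = ⊕-cancelʳ zero (trans (sym (fix _))
      (base-to-base e zero (fix zero) (fix (T̂ e ⊕ zero)) i))
      where
      fix = fixes-all e₀ τ0 τT

  module _ (π π′ : Shuffles) (same : ∀ e i → lookup (base π e) i ≡ lookup (base π′ e) i) where

    same-rim : ∀ e {j} → j < H → Block.rim π e j ≡ Block.rim π′ e j
    same-rim e {j} j<H = begin
      Block.rim π e j                  ≡⟨ interleave-odd (Block.hub π e) (Block.rim π e) j ⟨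
      Block.vertex π e (suc (j * 2))   ≡⟨ mod-injective (vertex<v π) (vertex<v π′) mods ⟩
      Block.vertex π′ e (suc (j * 2))  ≡⟨ interleave-odd (Block.hub π′ e) (Block.rim π′ e) j ⟩
      Block.rim π′ e j                 ∎
      where
      open ≡-Reasoning
      vertex<v : ∀ π → Block.vertex π e (suc (j * 2)) < v
      vertex<v π = Block.vertex<v π e (odd<k j<H)
      mods : Block.vertex π e (suc (j * 2)) mod v ≡ Block.vertex π′ e (suc (j * 2)) mod v
      mods = trans (sym (Cycles.lookup-at π e (odd<k j<H)))
        (trans (same e (at (suc (j * 2)))) (Cycles.lookup-at π′ e (odd<k j<H)))

    -- A rim vertex minus an offset independent of the shuffle gives back the difference `low`, and
    -- `low` is injective.
    same-slot : ∀ e {b} → b < p → Block.slot π e b ≡ Block.slot π′ e b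
    same-slot e {b} b<p with split D b
    ... | before b<D = low-injective (+-cancelˡ-≡ (T e + (D ∸ b)) _ _
      (trans (sym (Block.rim-dn π e b)) (trans (same-rim e (+-monoʳ-< (suc M) b<D)) (Block.rim-dn π′ e b))))
    ... | after r = low-injective (suc-injective (+-cancelˡ-≡ (mirror r) _ _
      (trans (sym (value π)) (trans (same-rim e j<H) (value π′)))))
      where
      r<M : r < M
      r<M = +-cancelˡ-< D r M b<p
      j<H : mirror r < H
      j<H = ≤-trans (mirror<M r<M) (≤-trans (m≤m+n M D) (n≤1+n _))
      value : ∀ π → Block.rim π e (mirror r) ≡ mirror r + suc (low (Block.slot π e (D + r)))
      value π = trans (Block.rim-up π e (mirror<M r<M)) (Block.up-mirror π e r<M)

    same-shuffles : ∀ {b} → b < p → ∀ e → π b ⟨$⟩ʳ e ≡ π′ b ⟨$⟩ʳ e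
    same-shuffles {b} b<p e = Fin.toℕ-injective (+-cancelˡ-≡ (n * b) _ _ (same-slot e b<p))

  -- Counting isomorphism classes.

  module _ {N} (shuffle : Fin N → Shuffles)
    (shuffle-injective : ∀ {i j} → (∀ {b} → b < p → ∀ e → shuffle i b ⟨$⟩ʳ e ≡ shuffle j b ⟨$⟩ʳ e) → i ≡ j)
    {classes : List (CyclicDesign v k)}
    (enumeration : IsEnumeration (DecSetoid.setoid (designSetoid v k)) classes)
    where

    private
      design : Fin N → CyclicDesign v k
      design i = Cycles.cyclicDesign (shuffle i)

      class : Fin N → Fin (length classes)
      class i = Any.index (enumeration (design i))

      iso : ∀ i → design i ≅ List.lookup classes (class i)
      iso i = Any.lookup-index (enumeration (design i))

      e₀ : Fin n
      e₀ = fromℕ< 1≤n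

      -- A class together with the images of 0 and T under the chosen isomorphism to its
      -- representative. Injectivity means that at most v² members of the family share a class.
      key : Fin N → Fin (length classes * (v * v))
      key i = combine (class i) (combine (proj₁ (iso i) ⟨$⟩ʳ zero) (proj₁ (iso i) ⟨$⟩ʳ T̂ e₀))

      -- One isomorphism followed by the inverse of the other fixes 0 and T. The representatives `R`
      -- and `R′` are variables so that their equality can be matched with `refl`.
      separate : ∀ {i j R R′} → R ≡ R′ → (σ : design i ≅ R) (σ′ : design j ≅ R′) →
        proj₁ σ ⟨$⟩ʳ zero ≡ proj₁ σ′ ⟨$⟩ʳ zero → proj₁ σ ⟨$⟩ʳ T̂ e₀ ≡ proj₁ σ′ ⟨$⟩ʳ T̂ e₀ → i ≡ j
      separate {i} {j} refl σ σ′ eq₀ eqT = shuffle-injective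
        (same-shuffles (shuffle i) (shuffle j)
          (same-base (shuffle i) (shuffle j) (proj₁ τ) (proj₁ (proj₂ τ)) e₀ (fixes eq₀) (fixes eqT)))
        where
        τ : design i ≅ design j
        τ = Isomorphic-trans σ (Isomorphic-sym σ′)
        fixes : ∀ {x} → proj₁ σ ⟨$⟩ʳ x ≡ proj₁ σ′ ⟨$⟩ʳ x → proj₁ τ ⟨$⟩ʳ x ≡ x
        fixes eq = trans (cong (proj₁ σ′ ⟨$⟩ˡ_) eq) (Perm.inverseˡ (proj₁ σ′))

      key-injective : ∀ {i j} → key i ≡ key j → i ≡ j
      key-injective {i} {j} eq =
        let c , xy = Fin.combine-injective (class i) _ (class j) _ eq
            x , y = Fin.combine-injective (proj₁ (iso i) ⟨$⟩ʳ zero) _ (proj₁ (iso j) ⟨$⟩ʳ zero) _ xy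
        in separate (cong (List.lookup (classes)) c) (iso i) (iso j) x y

    family-size≤ : N ≤ length classes * (v * v)
    family-size≤ = Fin.injective⇒≤ {f = key} key-injective

-- Numbering of permutations and of sequences of permutations.

-- A Lehmer code: the leading digit is the image of zero, the rest codes the permutation left after
-- removing it.
permutation : ∀ n → Fin (n !) → Permutation′ n
permutation zero    _ = Perm.id
permutation (suc n) i =
  let q , r = remQuot {suc n} (n !) i in insert zero q (permutation n r)

permutation-injective : ∀ n {i j} → (∀ x → permutation n i ⟨$⟩ʳ x ≡ permutation n j ⟨$⟩ʳ x) → i ≡ j
permutation-injective zero    {zero} {zero} _ = refl
permutation-injective (suc n) {i} {j} same = begin
  i                                         ≡⟨ Fin.combine-remQuot {suc n} (n !) i ⟨
  combine (head i) (tail i)                 ≡⟨ cong₂ combine heads (permutation-injective n tails) ⟩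
  combine (head j) (tail j)                 ≡⟨ Fin.combine-remQuot {suc n} (n !) j ⟩
  j                                         ∎
  where
  open ≡-Reasoning
  head : Fin (suc n !) → Fin (suc n)
  head i = proj₁ (remQuot {suc n} (n !) i)
  tail : Fin (suc n !) → Fin (n !)
  tail i = proj₂ (remQuot {suc n} (n !) i)
  σ : Fin (suc n !) → Permutation′ n
  σ i = permutation n (tail i)
  heads : head i ≡ head j
  heads = same zero
  tails : ∀ x → σ i ⟨$⟩ʳ x ≡ σ j ⟨$⟩ʳ x
  tails x = Fin.punchIn-injective (head i) _ _ (begin
    punchIn (head i) (σ i ⟨$⟩ʳ x)       ≡⟨ Perm.insert-punchIn zero (head i) (σ i) x ⟨
    permutation (suc n) i ⟨$⟩ʳ suc x    ≡⟨ same (suc x) ⟩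
    permutation (suc n) j ⟨$⟩ʳ suc x    ≡⟨ Perm.insert-punchIn zero (head j) (σ j) x ⟩
    punchIn (head j) (σ j ⟨$⟩ʳ x)       ≡⟨ cong (λ h → punchIn h (σ j ⟨$⟩ʳ x)) heads ⟨
    punchIn (head i) (σ j ⟨$⟩ʳ x)       ∎)

funToFin-cong : ∀ {m n} {f g : Fin m → Fin n} → (∀ x → f x ≡ g x) → funToFin f ≡ funToFin g
funToFin-cong {zero}  f≗g = refl
funToFin-cong {suc m} f≗g = cong₂ combine (f≗g zero) (funToFin-cong (f≗g ∘ suc))

-- The `p` digits of `i` in base n! number the permutations of the bands; `b mod p` extends the
-- sequence to all natural indices.
shuffles : ∀ n p .{{_ : NonZero p}} → Fin ((n !) ^ p) → ℕ → Permutation′ n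
shuffles n p i b = permutation n (finToFun i (b mod p))

shuffles-injective : ∀ n p .{{_ : NonZero p}} {i j} →
  (∀ {b} → b < p → ∀ e → shuffles n p i b ⟨$⟩ʳ e ≡ shuffles n p j b ⟨$⟩ʳ e) → i ≡ j
shuffles-injective n p@(suc _) {i} {j} same = begin
  i                                 ≡⟨ Fin.funToFin-finToFin {p} {n !} i ⟨
  funToFin {p} {n !} (finToFun i)   ≡⟨ funToFin-cong {p} {n !} digits ⟩
  funToFin {p} {n !} (finToFun j)   ≡⟨ Fin.funToFin-finToFin {p} {n !} j ⟩
  j                                 ∎
  where
  open ≡-Reasoning
  digits : ∀ x → finToFun {n !} {p} i x ≡ finToFun j x
  digits x = permutation-injective n λ e → subst
    (λ y → permutation n (finToFun i y) ⟨$⟩ʳ e ≡ permutation n (finToFun j y) ⟨$⟩ʳ e)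
    (mod-toℕ-id x) (same (Fin.toℕ<n x) e)

-- Choice of the parameters.

-- The bound `2 ≤ p`, that is k ≥ 7, is what makes the climb nonempty.
halves : ∀ p → 2 ≤ p → ∃[ M ] ∃[ ε ] 1 ≤ M × ε ≤ 1 × M + (M + ε) ≡ p
halves p 2≤p with parity p
halves _ 2≤p       | even (suc m) = suc m , 0 , s≤s z≤n , z≤n , solve (m ∷ [])
halves _ (s≤s ()) | odd zero
halves _ _         | odd (suc m) = suc m , 1 , s≤s z≤n , s≤s z≤n , solve (m ∷ [])

-- `γ` is whichever of 1 and 2 has the parity of n + ε, so that n + γ + ε is even and at least 2.
balanced : ∀ n ε → ∃[ γ ] ∃[ a ] (γ ≡ 1 ⊎ γ ≡ 2) × 2 * a + 2 ≡ n + γ + ε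
balanced n ε = aux (parity (n + ε)) refl
  where
  aux : ∀ {s} → Parity s → n + ε ≡ s → ∃[ γ ] ∃[ a ] (γ ≡ 1 ⊎ γ ≡ 2) × 2 * a + 2 ≡ n + γ + ε
  aux (even a) eq = 2 , a , inj₂ refl , (begin
    2 * a + 2   ≡⟨ cong (_+ 2) (*-comm 2 a) ⟩
    a * 2 + 2   ≡⟨ cong (_+ 2) eq ⟨
    n + ε + 2   ≡⟨ solve (n ∷ ε ∷ []) ⟩
    n + 2 + ε   ∎)
    where open ≡-Reasoning
  aux (odd a) eq = 1 , a , inj₁ refl , (begin
    2 * a + 2         ≡⟨ solve (a ∷ []) ⟩
    suc (a * 2) + 1   ≡⟨ cong (_+ 1) eq ⟨
    n + ε + 1         ≡⟨ solve (n ∷ ε ∷ []) ⟩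
    n + 1 + ε         ∎)
    where open ≡-Reasoning

Enumeration : ∀ v k → List (CyclicDesign v k) → Set
Enumeration v k = IsEnumeration (DecSetoid.setoid (designSetoid v k))

design-count : ∀ n p → 1 ≤ n → 2 ≤ p → let k = suc (suc p * 2); v = 2 * n * k + 1 in
  ∀ classes → Enumeration v k classes → (n !) ^ p ≤ length classes * (v * v)
design-count n p 1≤n 2≤p =
  let M , ε , 1≤M , ε≤1 , p≡ = halves p 2≤p
      γ , a , γ≡ , balance = balanced n ε
  -- The construction yields p as M + (M + ε) and v as 1 + n(2k); both are rewritten to the required
  -- form.
  in subst (λ v → Bound v p) (v≡ (suc (suc p * 2)))
       (subst (λ p → Bound (suc (n * (suc (suc p * 2) * 2))) p) p≡
         (bound M ε γ a 1≤M ε≤1 γ≡ balance))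
  where
  Bound : ℕ → ℕ → Set
  Bound v p = ∀ classes → Enumeration v (suc (suc p * 2)) classes → (n !) ^ p ≤ length classes * (v * v)

  bound : ∀ M ε γ a → 1 ≤ M → ε ≤ 1 → γ ≡ 1 ⊎ γ ≡ 2 → 2 * a + 2 ≡ n + γ + ε →
    let p = M + (M + ε) in Bound (suc (n * (suc (suc p * 2) * 2))) p
  bound M ε γ a 1≤M ε≤1 γ≡ balance classes enumeration =
    subst (λ p → (n !) ^ p ≤ length classes * (v * v)) (+-comm (M + ε) M)
      (family-size≤ (shuffles n (M + ε + M)) (shuffles-injective n (M + ε + M)) enumeration)
    where
    open Rigidity n M ε γ a 1≤n 1≤M ε≤1 γ≡ balance
    open Family n M ε γ a 1≤n 1≤M ε≤1 γ≡ balance using (v; k)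
    instance
      p≢0 : NonZero (M + ε + M)
      p≢0 = >-nonZero (≤-trans 1≤M (m≤n+m M (M + ε)))

  v≡ : ∀ k → suc (n * (k * 2)) ≡ 2 * n * k + 1
  v≡ k = solve (n ∷ k ∷ [])

-- Numerical estimates.

-- Nine is the least positive n with 4^n ≤ n!, and from there each step multiplies the right side by
-- at least 10.
exponential≤factorial : ∀ {n} → 9 ≤ n → 4 ^ n ≤ n !
exponential≤factorial {n} 9≤n = subst (λ n → 4 ^ n ≤ n !) (m+[n∸m]≡n 9≤n) (go (n ∸ 9))
  where
  go : ∀ m → 4 ^ (9 + m) ≤ (9 + m) !
  go zero    = ≤ᵇ⇒≤ (4 ^ 9) (9 !) _
  go (suc m) = subst (λ n → 4 ^ n ≤ n !) (sym (+-suc 9 m))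
    (*-mono-≤ (≤-trans (≤ᵇ⇒≤ 4 10 _) (m≤m+n 10 m)) (go m))

-- The constant is 63 = 9 · 7, with 9 coming from v² ≤ 9n²k² and 7 the least value of k.
square≤factorial : ∀ {n} → 9 ≤ n → 63 * (n * n) ≤ n !
square≤factorial {n} 9≤n = subst (λ n → 63 * (n * n) ≤ n !) (m+[n∸m]≡n 9≤n) (go (n ∸ 9))
  where
  go : ∀ m → 63 * ((9 + m) * (9 + m)) ≤ (9 + m) !
  go zero    = ≤ᵇ⇒≤ (63 * (9 * 9)) (9 !) _
  go (suc m) = subst (λ n → 63 * (n * n) ≤ n !) (sym (+-suc 9 m)) (begin
    63 * ((10 + m) * (10 + m))        ≤⟨ doubling ⟩
    2 * (63 * ((9 + m) * (9 + m)))    ≤⟨ *-mono-≤ (≤-trans (≤ᵇ⇒≤ 2 10 _) (m≤m+n 10 m)) (go m) ⟩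
    (10 + m) * (9 + m) !              ∎)
    where
    open ≤-Reasoning
    doubling : 63 * ((10 + m) * (10 + m)) ≤ 2 * (63 * ((9 + m) * (9 + m)))
    doubling = by-slack (63 * (m * m) + 1008 * m + 3906) (≤-refl {0}) (solve (m ∷ []))

-- The last factor on the left is k = 2s + 7. Passing to the next k at most doubles it, while the
-- right side gains a factor n! ≥ 2.
cubic≤factorial-power : ∀ {n} → 9 ≤ n → ∀ s → 9 * (n * n) * suc (suc (suc (suc s)) * 2) ≤ (n !) ^ suc s
cubic≤factorial-power {n} 9≤n zero = subst₂ _≤_ 63≡9*7 (sym (*-identityʳ (n !))) (square≤factorial 9≤n)
  where
  63≡9*7 : 63 * (n * n) ≡ 9 * (n * n) * 7
  63≡9*7 = solve (n ∷ [])
cubic≤factorial-power {n} 9≤n (suc s) = begin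
  9 * (n * n) * suc (suc (suc (suc (suc s))) * 2)   ≤⟨ doubling ⟩
  2 * (9 * (n * n) * suc (suc (suc (suc s)) * 2))   ≤⟨ *-mono-≤ 2≤n! (cubic≤factorial-power 9≤n s) ⟩
  n ! * (n !) ^ suc s                               ∎
  where
  open ≤-Reasoning
  doubling : 9 * (n * n) * suc (suc (suc (suc (suc s))) * 2) ≤ 2 * (9 * (n * n) * suc (suc (suc (suc s)) * 2))
  doubling = by-slack (9 * (n * n) * (2 * s + 5)) (≤-refl {0}) (solve (n ∷ s ∷ []))
  2≤n! : 2 ≤ n !
  2≤n! = ≤-trans (≤-trans (s≤s (s≤s z≤n)) (^-monoʳ-≤ 4 (≤-trans (s≤s z≤n) 9≤n))) (exponential≤factorial 9≤n)

v≤3nk : ∀ {n k} → 1 ≤ n → 1 ≤ k → 2 * n * k + 1 ≤ 3 * (n * k)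
v≤3nk {n} {k} 1≤n 1≤k = by-slack 0 (*-mono-≤ 1≤n 1≤k) (solve (n ∷ k ∷ []))

^-distribʳ-* : ∀ a b n → (a * b) ^ n ≡ a ^ n * b ^ n
^-distribʳ-* a b zero    = refl
^-distribʳ-* a b (suc n) = trans (cong (a * b *_) (^-distribʳ-* a b n)) (interchange (a ^ n) (b ^ n))
  where
  interchange : ∀ x y → a * b * (x * y) ≡ a * x * (b * y)
  interchange x y = solve (a ∷ b ∷ x ∷ y ∷ [])

-- After rounding 335 up to 4 · 100, one factor n! pays for 4^n and the other p - 1 pay for 9n²k. Of
-- the k² in v² ≤ 9n²k², one k remains as the denominator of the bound.
exponential≤classes : ∀ {n s c} → 9 ≤ n → let p = suc (suc s); k = suc (suc p * 2); v = 2 * n * k + 1 in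
  (n !) ^ p ≤ c * (v * v) → 335 ^ n ≤ c * (k * 100 ^ n)
exponential≤classes {n} {s} {c} 9≤n count = *-cancelʳ-≤ (335 ^ n) (c * (k * 100 ^ n)) (v * v) {{v²≢0}} (begin
  335 ^ n * (v * v)
    ≤⟨ *-mono-≤ (^-monoˡ-≤ n (≤ᵇ⇒≤ 335 400 _)) (*-mono-≤ v≤ v≤) ⟩
  400 ^ n * (3 * (n * k) * (3 * (n * k)))
    ≡⟨ cong (_* (3 * (n * k) * (3 * (n * k)))) (^-distribʳ-* 4 100 n) ⟩
  4 ^ n * 100 ^ n * (3 * (n * k) * (3 * (n * k)))
    ≡⟨ regroup (4 ^ n) (100 ^ n) n k ⟩
  4 ^ n * (9 * (n * n) * k) * (k * 100 ^ n)
    ≤⟨ *-monoˡ-≤ (k * 100 ^ n)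
         (*-mono-≤ (exponential≤factorial 9≤n) (cubic≤factorial-power 9≤n s)) ⟩
  n ! * (n !) ^ suc s * (k * 100 ^ n)
    ≤⟨ *-monoˡ-≤ (k * 100 ^ n) count ⟩
  c * (v * v) * (k * 100 ^ n)
    ≡⟨ swap c (v * v) (k * 100 ^ n) ⟩
  c * (k * 100 ^ n) * (v * v) ∎)
  where
  open ≤-Reasoning
  k v : ℕ
  k = suc (suc (suc (suc s)) * 2)
  v = 2 * n * k + 1
  v≤ : v ≤ 3 * (n * k)
  v≤ = v≤3nk {n} {k} (≤-trans (s≤s z≤n) 9≤n) (s≤s z≤n)
  v≢0 : NonZero v
  v≢0 = >-nonZero (m≤n+m 1 (2 * n * k))
  v²≢0 : NonZero (v * v)
  v²≢0 = m*n≢0 v v {{v≢0}} {{v≢0}}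
  regroup : ∀ x y n k → x * y * (3 * (n * k) * (3 * (n * k))) ≡ x * (9 * (n * n) * k) * (k * y)
  regroup x y n k = solve (x ∷ y ∷ n ∷ k ∷ [])
  swap : ∀ x y z → x * y * z ≡ x * z * y
  swap x y z = solve (x ∷ y ∷ z ∷ [])

odd>5 : ∀ k → k > 5 → 2 ∤ k → ∃[ s ] suc (suc (suc (suc s)) * 2) ≡ k
odd>5 k k>5 2∤k with parity k
... | even j                        = contradiction (divides j refl) 2∤k
... | odd (suc (suc (suc s)))       = s , refl
odd>5 _ (s≤s ()) _              | odd 0
odd>5 _ (s≤s (s≤s (s≤s ()))) _  | odd 1
odd>5 _ (s≤s (s≤s (s≤s (s≤s (s≤s ()))))) _ | odd 2

class-count : ∀ {n k} → 9 ≤ n → k > 5 → 2 ∤ k → ∀ classes → Enumeration (2 * n * k + 1) k classes →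
  335 ^ n ≤ length classes * (k * 100 ^ n)
class-count {n} {k} 9≤n k>5 2∤k =
  let s , k≡ = odd>5 k k>5 2∤k
  in subst (λ k → ∀ classes → Enumeration (2 * n * k + 1) k classes →
                  335 ^ n ≤ length classes * (k * 100 ^ n)) k≡
       λ classes enumeration → exponential≤classes {n} {s} {length classes} 9≤n
         (design-count n (suc (suc s)) (≤-trans (s≤s z≤n) 9≤n) (s≤s (s≤s z≤n)) classes enumeration)

-- Passage to rational numbers.

open import Data.Integer.Base as ℤ using (+_)

fraction-* : ∀ a b c d .{{_ : NonZero b}} .{{_ : NonZero d}} .{{_ : NonZero (b * d)}} →
  (+ a ℚᵘ./ b) ℚᵘ.* (+ c ℚᵘ./ d) ≃ + (a * c) ℚᵘ./ (b * d)
fraction-* a (suc b) c (suc d) = ℚᵘ.≃-reflexive (cong (λ i → mkℚᵘ i _) (sym (ℤ.pos-* a c)))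

toℚᵘ-/ : ∀ a b .{{_ : NonZero b}} → toℚᵘ (+ a / b) ≃ + a ℚᵘ./ b
toℚᵘ-/ a (suc b) = ℚ.toℚᵘ-fromℚᵘ (mkℚᵘ (+ a) b)

-- Unnormalised fractions multiply without reduction, so the power keeps the literal form a^n over
-- b^n, up to `≃`.
fraction-^ : ∀ a b .{{_ : NonZero b}} n → toℚᵘ ((+ a / b) ^ℚ n) ≃ ℚᵘ._/_ (+ (a ^ n)) (b ^ n) {{m^n≢0 b n}}
fraction-^ a b zero    = ℚᵘ.≃-refl
fraction-^ a b (suc n) = ℚᵘ.≃-trans (ℚ.toℚᵘ-homo-* (+ a / b) ((+ a / b) ^ℚ n))
  (ℚᵘ.≃-trans (ℚᵘ.*-cong (toℚᵘ-/ a b) (fraction-^ a b n))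
    (fraction-* a b (a ^ n) (b ^ n) {{_}} {{m^n≢0 b n}} {{m^n≢0 b (suc n)}}))

fraction-≤ : ∀ a b c .{{_ : NonZero b}} → a ≤ c * b → (+ a ℚᵘ./ b) ℚᵘ.≤ (+ c ℚᵘ./ 1)
fraction-≤ a (suc b) c a≤cb = *≤*
  (subst₂ ℤ._≤_ (sym (ℤ.*-identityʳ (+ a))) (ℤ.pos-* c (suc b)) (ℤ.+≤+ a≤cb))

power-ratio-≤ : ∀ a b n k c .{{_ : NonZero b}} .{{_ : NonZero k}} → a ^ n ≤ c * (k * b ^ n) →
  (+ c / 1) ℚ.≥ ((+ a / b) ^ℚ n) ℚ.* (+ 1 / k)
power-ratio-≤ a b n k c bound = ℚ.toℚᵘ-cancel-≤ (begin
  toℚᵘ (((+ a / b) ^ℚ n) ℚ.* (+ 1 / k))            ≃⟨ ℚ.toℚᵘ-homo-* ((+ a / b) ^ℚ n) (+ 1 / k) ⟩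
  toℚᵘ ((+ a / b) ^ℚ n) ℚᵘ.* toℚᵘ (+ 1 / k)        ≃⟨ ℚᵘ.*-cong (fraction-^ a b n) (toℚᵘ-/ 1 k) ⟩
  (+ (a ^ n) ℚᵘ./ (b ^ n)) ℚᵘ.* (+ 1 ℚᵘ./ k)           ≃⟨ fraction-* (a ^ n) (b ^ n) 1 k ⟩
  + (a ^ n * 1) ℚᵘ./ (b ^ n * k)                       ≤⟨ fraction-≤ (a ^ n * 1) (b ^ n * k) c bound′ ⟩
  + c ℚᵘ./ 1                                           ≃⟨ toℚᵘ-/ c 1 ⟨
  toℚᵘ (+ c / 1)                                     ∎)
  where
  open ℚᵘ.≤-Reasoning
  instance
    bⁿ≢0 : NonZero (b ^ n)
    bⁿ≢0 = m^n≢0 b n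
    bⁿk≢0 : NonZero (b ^ n * k)
    bⁿk≢0 = m*n≢0 (b ^ n) k
  bound′ : a ^ n * 1 ≤ c * (b ^ n * k)
  bound′ = subst₂ _≤_ (sym (*-identityʳ (a ^ n))) (cong (c *_) (*-comm k (b ^ n))) bound

-- Leaving the numerator `a` free up to 335 lets one bound serve both 2.49 and 3.35.
power≤classes : ∀ {n k c} .{{_ : NonZero k}} → 9 ≤ n → k > 5 → 2 ∤ k →
  ∀ classes → Enumeration (2 * n * k + 1) k classes → length classes ≡ c →
  ∀ a → a ≤ 335 → (+ c / 1) ℚ.≥ ((+ a / 100) ^ℚ n) ℚ.* (+ 1 / k)
power≤classes {n} {k} 9≤n k>5 2∤k classes enumeration refl a a≤335 =
  power-ratio-≤ a 100 n k (length classes)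
    (≤-trans (^-monoˡ-≤ n a≤335) (class-count {n} {k} 9≤n k>5 2∤k classes enumeration))

proposition7 : ∃ λ (N : ℕ) → ∀ n → n > 1 → n ≥ N →
    ∀ k → .{{_ : NonZero k}} → k > 5 → 2 ∤ k →
    (n % 7 ≢ 4 →
    (+ NC (2 * n * k + 1) k / 1) ℚ.≥ ((+ 249 / 100) ^ℚ n) ℚ.* (+ 1 / k))
    × (n % 7 ≡ 4 →
    (+ NC (2 * n * k + 1) k / 1) ℚ.≥ ((+ 335 / 100) ^ℚ n) ℚ.* (+ 1 / k))
-- 9 is the threshold of the factorial estimates.
proposition7 = 9 , λ n _ 9≤n k k>5 2∤k →
  let bound = power≤classes {n} {k} {NC (2 * n * k + 1) k} 9≤n k>5 2∤k _
                (representatives-complete (2 * n * k + 1) k) refl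
  in (λ _ → bound 249 (≤ᵇ⇒≤ 249 335 _)) , (λ _ → bound 335 ≤-refl)
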